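{- Let $\beta>1$ be an Ito-Sadahiro number, with $d_{ -\beta}(l_\beta)=d_1\cdots d_m\,(d_{m+1}\cdots d_{m+p})^\omega$, where $m\ge0$, $p\ge1$ are minimal such that $d_{ -\beta}(l_\beta)$ can be written in this form, and let $$P(x)=(-x)^{m+1}\sum_{i=0}^{p-1}(-x)^i+\big((-x)^p-1\big)\sum_{i=1}^m d_i(-x)^{m-i}+\sum_{i=m+1}^{m+p}d_i(-x)^{m+p-i}$$ be its Ito-Sadahiro polynomial. Then every complex root $\gamma\neq\beta$ of $P$ satisfies $|\gamma|<2$. In particular, every algebraic conjugate $\gamma\ne\beta$ of $\beta$ satisfies $|\gamma|<2$.
   Context: For $\beta>1$ put $l_\beta=-\frac{\beta}{\beta+1}$, $r_\beta=\frac{1}{\beta+1}$ and $I_\beta=[l_\beta,r_\beta)$. Define $T:I_\beta\to I_\beta$ by $T(x)=-\beta x-\lfloor -\beta x-l_\beta\rfloor$. The $(-\beta)$-expansion of $x\in I_\beta$ is the infinite word $d_{ -\beta}(x)=x_1x_2x_3\cdots$ with $x_i=\lfloor -\beta T^{i-1}(x)-l_\beta\rfloor$ for $i\ge1$; then $x=\sum_{i\ge1}x_i(-\beta)^{ -i}$. The notation $w^\omega$ denotes infinite repetition of the finite word $w$. A number $\beta>1$ is an Ito-Sadahiro number if $d_{ -\beta}(l_\beta)$ is eventually periodic. -}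

module Defs where

open import Algebra.Bundles.Raw using (RawRing)
open import Data.Bool.Base using (true; false; T; if_then_else_)
open import Data.Fin.Base using (Fin; toℕ)
open import Data.Integer.Base as ℤ using (ℤ; +_)
import Data.Integer.Properties as ℤ
open import Data.Nat.Base as ℕ using (ℕ; zero; suc; _∸_)
import Data.Nat.Properties as ℕ
open import Data.Product.Base using (_×_; _,_; proj₁; proj₂; ∃-syntax; Σ-syntax)
open import Data.Rational.Base as ℚ using (ℚ; 0ℚ; 1ℚ)
import Data.Rational.Properties as ℚ
import Data.Rational.Unnormalised.Base as ℚᵘ
import Data.Rational.Unnormalised.Properties as ℚᵘ
open import Data.Rational.Solver using (module +-*-Solver)
open import Data.Sum.Base using (_⊎_; inj₁; inj₂)
open import Data.Vec.Functional using (Vector)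
open import Level using (0ℓ)
open import Relation.Binary.PropositionalEquality
open import Relation.Nullary using (¬_)
open import Relation.Nullary.Negation using (contradiction)

open +-*-Solver using (solve; _:+_; _:*_; _:-_; :-_; _:=_; con)

IsCauchy : (ℕ → ℚ) → Set
IsCauchy f = ∀ ε → 0ℚ ℚ.< ε →
  ∃[ N ] ∀ m n → N ℕ.≤ m → N ℕ.≤ n → ℚ.∣ f m ℚ.- f n ∣ ℚ.< ε

∣p-p∣≡0 : ∀ p → ℚ.∣ p ℚ.- p ∣ ≡ 0ℚ
∣p-p∣≡0 p = cong ℚ.∣_∣ (ℚ.+-inverseʳ p)

opaque

  const-isCauchy : ∀ q → IsCauchy (λ _ → q)
  const-isCauchy q ε 0<ε = 0 , λ _ _ _ _ → subst (ℚ._< ε) (sym (∣p-p∣≡0 q)) 0<ε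

module _ {C : ℚ} (0<C : 0ℚ ℚ.< C) {ε : ℚ} (0<ε : 0ℚ ℚ.< ε) where

  private
    instance
      2C-pos : ℚ.Positive (C ℚ.+ C)
      2C-pos = ℚ.positive (ℚ.+-mono-< 0<C 0<C)
      2C-nonZero : ℚ.NonZero (C ℚ.+ C)
      2C-nonZero = ℚ.pos⇒nonZero (C ℚ.+ C)
      ε-pos : ℚ.Positive ε
      ε-pos = ℚ.positive 0<ε
      1/2C-pos : ℚ.Positive (ℚ.1/ (C ℚ.+ C))
      1/2C-pos = ℚ.1/pos⇒pos (C ℚ.+ C)

  split : ∃[ δ ] 0ℚ ℚ.< δ × C ℚ.* (δ ℚ.+ δ) ≡ ε
  split = δ , ℚ.positive⁻¹ δ {{ℚ.pos*pos⇒pos ε (ℚ.1/ (C ℚ.+ C))}} , (begin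
      C ℚ.* (δ ℚ.+ δ)
        ≡⟨ solve 3 (λ c e i → c :* (e :* i :+ e :* i) := e :* ((c :+ c) :* i)) refl C ε i ⟩
      ε ℚ.* ((C ℚ.+ C) ℚ.* i)
        ≡⟨ cong (ε ℚ.*_) (ℚ.*-inverseʳ (C ℚ.+ C)) ⟩
      ε ℚ.* 1ℚ
        ≡⟨ ℚ.*-identityʳ ε ⟩
      ε ∎)
    where
    open ≡-Reasoning
    i δ : ℚ
    i = ℚ.1/ (C ℚ.+ C)
    δ = ε ℚ.* i

cauchy-lipschitz₂ : (f g h : ℕ → ℚ) → IsCauchy f → IsCauchy g →
  (C : ℚ) → 0ℚ ℚ.< C → (M : ℕ) →
  (∀ m n → M ℕ.≤ m → M ℕ.≤ n →
    ℚ.∣ h m ℚ.- h n ∣ ℚ.≤ C ℚ.* (ℚ.∣ f m ℚ.- f n ∣ ℚ.+ ℚ.∣ g m ℚ.- g n ∣)) →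
  IsCauchy h
cauchy-lipschitz₂ f g h cf cg C 0<C M lip ε 0<ε = N , λ m n N≤m N≤n →
    bound ℚ.∣ f m ℚ.- f n ∣ ℚ.∣ g m ℚ.- g n ∣ ℚ.∣ h m ℚ.- h n ∣
      (lip m n (ℕ.≤-trans M≤N N≤m) (ℕ.≤-trans M≤N N≤n))
      (proj₂ (cf δ 0<δ) m n (ℕ.≤-trans N₁≤N N≤m) (ℕ.≤-trans N₁≤N N≤n))
      (proj₂ (cg δ 0<δ) m n (ℕ.≤-trans N₂≤N N≤m) (ℕ.≤-trans N₂≤N N≤n))
  where
  δ : ℚ
  δ = proj₁ (split 0<C 0<ε)
  0<δ : 0ℚ ℚ.< δ
  0<δ = proj₁ (proj₂ (split 0<C 0<ε))
  eq : C ℚ.* (δ ℚ.+ δ) ≡ ε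
  eq = proj₂ (proj₂ (split 0<C 0<ε))
  N₁ N₂ : ℕ
  N₁ = proj₁ (cf δ 0<δ)
  N₂ = proj₁ (cg δ 0<δ)
  N : ℕ
  N = M ℕ.+ (N₁ ℕ.+ N₂)
  bound : ∀ x y z → z ℚ.≤ C ℚ.* (x ℚ.+ y) → x ℚ.< δ → y ℚ.< δ → z ℚ.< ε
  bound x y z z≤ x<δ y<δ = begin-strict
    z                 ≤⟨ z≤ ⟩
    C ℚ.* (x ℚ.+ y)   <⟨ ℚ.*-monoʳ-<-pos C {{ℚ.positive 0<C}} {x ℚ.+ y} {δ ℚ.+ δ}
                           (ℚ.+-mono-< {x} {δ} {y} {δ} x<δ y<δ) ⟩
    C ℚ.* (δ ℚ.+ δ)   ≡⟨ eq ⟩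
    ε                 ∎
    where open ℚ.≤-Reasoning
  M≤N : M ℕ.≤ N
  M≤N = ℕ.m≤m+n M _
  N₁≤N : N₁ ℕ.≤ N
  N₁≤N = ℕ.≤-trans (ℕ.m≤m+n N₁ N₂) (ℕ.m≤n+m _ M)
  N₂≤N : N₂ ℕ.≤ N
  N₂≤N = ℕ.≤-trans (ℕ.m≤n+m N₂ N₁) (ℕ.m≤n+m _ M)

0<1 : 0ℚ ℚ.< 1ℚ
0<1 = ℚ.*<* (ℤ.+<+ (ℕ.s≤s ℕ.z≤n))

bounded : ∀ f → IsCauchy f →
  ∃[ B ] 0ℚ ℚ.< B × ∃[ N ] (∀ n → N ℕ.≤ n → ℚ.∣ f n ∣ ℚ.≤ B)
bounded f cf =
  let (N , p) = cf 1ℚ 0<1 in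
    1ℚ ℚ.+ ℚ.∣ f N ∣
  , ℚ.<-≤-trans 0<1
      (subst (ℚ._≤ 1ℚ ℚ.+ ℚ.∣ f N ∣) (ℚ.+-identityʳ 1ℚ) (ℚ.+-monoʳ-≤ 1ℚ (ℚ.0≤∣p∣ (f N))))
  , N
  , λ n N≤n → begin
      ℚ.∣ f n ∣
        ≡⟨ cong ℚ.∣_∣ (solve 2 (λ a b → a := (a :- b) :+ b) refl (f n) (f N)) ⟩
      ℚ.∣ (f n ℚ.- f N) ℚ.+ f N ∣
        ≤⟨ ℚ.∣p+q∣≤∣p∣+∣q∣ (f n ℚ.- f N) (f N) ⟩
      ℚ.∣ f n ℚ.- f N ∣ ℚ.+ ℚ.∣ f N ∣
        ≤⟨ ℚ.+-monoˡ-≤ ℚ.∣ f N ∣ (ℚ.<⇒≤ (p n N N≤n ℕ.≤-refl)) ⟩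
      1ℚ ℚ.+ ℚ.∣ f N ∣ ∎
  where open ℚ.≤-Reasoning

opaque

  +-isCauchy : ∀ f g → IsCauchy f → IsCauchy g → IsCauchy (λ n → f n ℚ.+ g n)
  +-isCauchy f g cf cg = cauchy-lipschitz₂ f g (λ n → f n ℚ.+ g n) cf cg 1ℚ 0<1 0 λ m n _ _ → begin
      ℚ.∣ (f m ℚ.+ g m) ℚ.- (f n ℚ.+ g n) ∣
        ≡⟨ cong ℚ.∣_∣ (solve 4 (λ a b c d → (a :+ b) :- (c :+ d) := (a :- c) :+ (b :- d))
             refl (f m) (g m) (f n) (g n)) ⟩
      ℚ.∣ (f m ℚ.- f n) ℚ.+ (g m ℚ.- g n) ∣
        ≤⟨ ℚ.∣p+q∣≤∣p∣+∣q∣ (f m ℚ.- f n) (g m ℚ.- g n) ⟩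
      ℚ.∣ f m ℚ.- f n ∣ ℚ.+ ℚ.∣ g m ℚ.- g n ∣
        ≡⟨ ℚ.*-identityˡ _ ⟨
      1ℚ ℚ.* (ℚ.∣ f m ℚ.- f n ∣ ℚ.+ ℚ.∣ g m ℚ.- g n ∣) ∎
    where open ℚ.≤-Reasoning

  neg-isCauchy : ∀ f → IsCauchy f → IsCauchy (λ n → ℚ.- f n)
  neg-isCauchy f cf ε 0<ε =
    let (N , p) = cf ε 0<ε in
    N , λ m n N≤m N≤n → subst (ℚ._< ε) (eq m n) (p m n N≤m N≤n)
    where
    eq : ∀ m n → ℚ.∣ f m ℚ.- f n ∣ ≡ ℚ.∣ (ℚ.- f m) ℚ.- (ℚ.- f n) ∣
    eq m n = trans (sym (ℚ.∣-p∣≡∣p∣ (f m ℚ.- f n)))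
      (cong ℚ.∣_∣ (solve 2 (λ a b → :- (a :- b) := (:- a) :- (:- b)) refl (f m) (f n)))

  *-isCauchy : ∀ f g → IsCauchy f → IsCauchy g → IsCauchy (λ n → f n ℚ.* g n)
  *-isCauchy f g cf cg =
    let (A , 0<A , N₁ , p₁) = bounded f cf
        (B , 0<B , N₂ , p₂) = bounded g cg
    in
    cauchy-lipschitz₂ f g (λ n → f n ℚ.* g n) cf cg (A ℚ.+ B) (ℚ.+-mono-< 0<A 0<B) (N₁ ℕ.+ N₂) λ m n N≤m N≤n →
      let x = ℚ.∣ f m ℚ.- f n ∣
          y = ℚ.∣ g m ℚ.- g n ∣
          instance
            x-nonNeg : ℚ.NonNegative x
            x-nonNeg = ℚ.∣-∣-nonNeg (f m ℚ.- f n)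
            y-nonNeg : ℚ.NonNegative y
            y-nonNeg = ℚ.∣-∣-nonNeg (g m ℚ.- g n)
            A-nonNeg : ℚ.NonNegative A
            A-nonNeg = ℚ.nonNegative (ℚ.<⇒≤ 0<A)
            B-nonNeg : ℚ.NonNegative B
            B-nonNeg = ℚ.nonNegative (ℚ.<⇒≤ 0<B)
      in begin
      ℚ.∣ f m ℚ.* g m ℚ.- f n ℚ.* g n ∣
        ≡⟨ cong ℚ.∣_∣ (solve 4 (λ a b c d → a :* b :- c :* d := a :* (b :- d) :+ d :* (a :- c))
             refl (f m) (g m) (f n) (g n)) ⟩
      ℚ.∣ f m ℚ.* (g m ℚ.- g n) ℚ.+ g n ℚ.* (f m ℚ.- f n) ∣
        ≤⟨ ℚ.∣p+q∣≤∣p∣+∣q∣ (f m ℚ.* (g m ℚ.- g n)) (g n ℚ.* (f m ℚ.- f n)) ⟩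
      ℚ.∣ f m ℚ.* (g m ℚ.- g n) ∣ ℚ.+ ℚ.∣ g n ℚ.* (f m ℚ.- f n) ∣
        ≡⟨ cong₂ ℚ._+_ (ℚ.∣p*q∣≡∣p∣*∣q∣ (f m) (g m ℚ.- g n)) (ℚ.∣p*q∣≡∣p∣*∣q∣ (g n) (f m ℚ.- f n)) ⟩
      ℚ.∣ f m ∣ ℚ.* y ℚ.+ ℚ.∣ g n ∣ ℚ.* x
        ≤⟨ ℚ.+-mono-≤
             (ℚ.*-monoʳ-≤-nonNeg y {ℚ.∣ f m ∣} {A} (p₁ m (ℕ.≤-trans (ℕ.m≤m+n N₁ N₂) N≤m)))
             (ℚ.*-monoʳ-≤-nonNeg x {ℚ.∣ g n ∣} {B} (p₂ n (ℕ.≤-trans (ℕ.m≤n+m N₂ N₁) N≤n))) ⟩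
      A ℚ.* y ℚ.+ B ℚ.* x
        ≡⟨ ℚ.+-identityʳ _ ⟨
      A ℚ.* y ℚ.+ B ℚ.* x ℚ.+ 0ℚ
        ≤⟨ ℚ.+-monoʳ-≤ (A ℚ.* y ℚ.+ B ℚ.* x)
             (ℚ.+-mono-≤ (ℚ.nonNegative⁻¹ (A ℚ.* x) {{ℚ.nonNeg*nonNeg⇒nonNeg A x}})
                         (ℚ.nonNegative⁻¹ (B ℚ.* y) {{ℚ.nonNeg*nonNeg⇒nonNeg B y}})) ⟩
      A ℚ.* y ℚ.+ B ℚ.* x ℚ.+ (A ℚ.* x ℚ.+ B ℚ.* y)
        ≡⟨ solve 4 (λ a b x y → a :* y :+ b :* x :+ (a :* x :+ b :* y) := (a :+ b) :* (x :+ y))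
             refl A B x y ⟩
      (A ℚ.+ B) ℚ.* (x ℚ.+ y) ∎
    where open ℚ.≤-Reasoning

opaque

  shift-isCauchy : ∀ f k → IsCauchy f → IsCauchy (λ n → f (k ℕ.+ n))
  shift-isCauchy f k cf ε 0<ε =
    let (N , p) = cf ε 0<ε in
    N , λ m n N≤m N≤n →
      p (k ℕ.+ m) (k ℕ.+ n) (ℕ.≤-trans N≤m (ℕ.m≤n+m m k)) (ℕ.≤-trans N≤n (ℕ.m≤n+m n k))

module _ (f : ℕ → ℚ) (cf : IsCauchy f) {ε : ℚ} (0<ε : 0ℚ ℚ.< ε) (ε<f : ∀ n → ε ℚ.< f n) where

  private
    f-pos : ∀ n → ℚ.Positive (f n)
    f-pos n = ℚ.positive (ℚ.<-trans 0<ε (ε<f n))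

    instance
      ε-pos : ℚ.Positive ε
      ε-pos = ℚ.positive 0<ε
      ε-nonZero : ℚ.NonZero ε
      ε-nonZero = ℚ.pos⇒nonZero ε
      f-nonZero : ∀ {n} → ℚ.NonZero (f n)
      f-nonZero {n} = ℚ.pos⇒nonZero (f n) {{f-pos n}}

  1/-seq : ℕ → ℚ
  1/-seq n = ℚ.1/ f n

  private
    e : ℚ
    e = ℚ.1/ ε

    e-pos : ℚ.Positive e
    e-pos = ℚ.1/pos⇒pos ε

    1/-pos : ∀ n → ℚ.Positive (1/-seq n)
    1/-pos n = ℚ.1/pos⇒pos (f n) {{f-pos n}}

    1/-nonNeg : ∀ n → ℚ.NonNegative (1/-seq n)
    1/-nonNeg n = ℚ.pos⇒nonNeg (1/-seq n) {{1/-pos n}}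

    e-nonNeg : ℚ.NonNegative e
    e-nonNeg = ℚ.pos⇒nonNeg e {{e-pos}}

    1/≤e : ∀ n → 1/-seq n ℚ.≤ e
    1/≤e n = begin
      i                  ≡⟨ ℚ.*-identityʳ i ⟨
      i ℚ.* 1ℚ           ≡⟨ cong (i ℚ.*_) (ℚ.*-inverseʳ ε) ⟨
      i ℚ.* (ε ℚ.* e)    ≤⟨ ℚ.*-monoˡ-≤-nonNeg i {{1/-nonNeg n}} {ε ℚ.* e} {f n ℚ.* e}
                              (ℚ.*-monoʳ-≤-nonNeg e {{e-nonNeg}} {ε} {f n} (ℚ.<⇒≤ (ε<f n))) ⟩
      i ℚ.* (f n ℚ.* e)  ≡⟨ solve 3 (λ i x e → i :* (x :* e) := (x :* i) :* e) refl i (f n) e ⟩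
      (f n ℚ.* i) ℚ.* e  ≡⟨ cong (ℚ._* e) (ℚ.*-inverseʳ (f n)) ⟩
      1ℚ ℚ.* e           ≡⟨ ℚ.*-identityˡ e ⟩
      e                  ∎
      where
      open ℚ.≤-Reasoning
      i : ℚ
      i = 1/-seq n

    1/-diff : ∀ m n → 1/-seq m ℚ.- 1/-seq n ≡ (ℚ.- (f m ℚ.- f n)) ℚ.* (1/-seq m ℚ.* 1/-seq n)
    1/-diff m n = begin
      i ℚ.- j
        ≡⟨ cong₂ ℚ._-_ (ℚ.*-identityˡ i) (ℚ.*-identityˡ j) ⟨
      1ℚ ℚ.* i ℚ.- 1ℚ ℚ.* j
        ≡⟨ cong₂ (λ u v → u ℚ.* i ℚ.- v ℚ.* j) (ℚ.*-inverseʳ (f n)) (ℚ.*-inverseʳ (f m)) ⟨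
      (f n ℚ.* j) ℚ.* i ℚ.- (f m ℚ.* i) ℚ.* j
        ≡⟨ solve 4 (λ x y i j → (y :* j) :* i :- (x :* i) :* j := (:- (x :- y)) :* (i :* j))
             refl (f m) (f n) i j ⟩
      (ℚ.- (f m ℚ.- f n)) ℚ.* (i ℚ.* j) ∎
      where
      open ≡-Reasoning
      i j : ℚ
      i = 1/-seq m
      j = 1/-seq n

    1/-lipschitz : ∀ m n → ℚ.∣ 1/-seq m ℚ.- 1/-seq n ∣ ℚ.≤
      (e ℚ.* e) ℚ.* (ℚ.∣ f m ℚ.- f n ∣ ℚ.+ ℚ.∣ f m ℚ.- f n ∣)
    1/-lipschitz m n = begin
      ℚ.∣ i ℚ.- j ∣
        ≡⟨ cong ℚ.∣_∣ (1/-diff m n) ⟩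
      ℚ.∣ (ℚ.- d) ℚ.* (i ℚ.* j) ∣
        ≡⟨ ℚ.∣p*q∣≡∣p∣*∣q∣ (ℚ.- d) (i ℚ.* j) ⟩
      ℚ.∣ ℚ.- d ∣ ℚ.* ℚ.∣ i ℚ.* j ∣
        ≡⟨ cong₂ ℚ._*_ (ℚ.∣-p∣≡∣p∣ d)
             (ℚ.0≤p⇒∣p∣≡p (ℚ.nonNegative⁻¹ (i ℚ.* j) {{ij-nonNeg}})) ⟩
      D ℚ.* (i ℚ.* j)
        ≤⟨ ℚ.*-monoˡ-≤-nonNeg D {{D-nonNeg}} {i ℚ.* j} {e ℚ.* e} ij≤ee ⟩
      D ℚ.* (e ℚ.* e)
        ≡⟨ solve 2 (λ d c → d :* c := c :* d) refl D (e ℚ.* e) ⟩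
      (e ℚ.* e) ℚ.* D
        ≤⟨ ℚ.*-monoˡ-≤-nonNeg (e ℚ.* e) {{ee-nonNeg}} {D} {D ℚ.+ D} D≤D+D ⟩
      (e ℚ.* e) ℚ.* (D ℚ.+ D) ∎
      where
      open ℚ.≤-Reasoning
      i j d D : ℚ
      i = 1/-seq m
      j = 1/-seq n
      d = f m ℚ.- f n
      D = ℚ.∣ d ∣
      D-nonNeg : ℚ.NonNegative D
      D-nonNeg = ℚ.∣-∣-nonNeg d
      ij-nonNeg : ℚ.NonNegative (i ℚ.* j)
      ij-nonNeg = ℚ.nonNeg*nonNeg⇒nonNeg i {{1/-nonNeg m}} j {{1/-nonNeg n}}
      ee-nonNeg : ℚ.NonNegative (e ℚ.* e)
      ee-nonNeg = ℚ.nonNeg*nonNeg⇒nonNeg e {{e-nonNeg}} e {{e-nonNeg}}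
      ij≤ee : i ℚ.* j ℚ.≤ e ℚ.* e
      ij≤ee = ℚ.≤-trans (ℚ.*-monoˡ-≤-nonNeg i {{1/-nonNeg m}} {j} {e} (1/≤e n))
                        (ℚ.*-monoʳ-≤-nonNeg e {{e-nonNeg}} {i} {e} (1/≤e m))
      D≤D+D : D ℚ.≤ D ℚ.+ D
      D≤D+D = subst (ℚ._≤ D ℚ.+ D) (ℚ.+-identityʳ D)
                (ℚ.+-monoʳ-≤ D {0ℚ} {D} (ℚ.nonNegative⁻¹ D {{D-nonNeg}}))

  opaque

    1/-isCauchy : IsCauchy 1/-seq
    1/-isCauchy = cauchy-lipschitz₂ f f 1/-seq cf cf (e ℚ.* e)
      (ℚ.positive⁻¹ (e ℚ.* e) {{ℚ.pos*pos⇒pos e {{e-pos}} e {{e-pos}}}}) 0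
      (λ m n _ _ → 1/-lipschitz m n)

⌊√_⌋ : ℕ → ℕ
⌊√ zero ⌋  = zero
⌊√ suc n ⌋ =
  if suc ⌊√ n ⌋ ℕ.* suc ⌊√ n ⌋ ℕ.≤ᵇ suc n then suc ⌊√ n ⌋ else ⌊√ n ⌋

⌊√⌋-spec : ∀ n → ⌊√ n ⌋ ℕ.* ⌊√ n ⌋ ℕ.≤ n × n ℕ.< suc ⌊√ n ⌋ ℕ.* suc ⌊√ n ⌋
⌊√⌋-spec zero = ℕ.z≤n , ℕ.s≤s ℕ.z≤n
⌊√⌋-spec (suc n) with suc ⌊√ n ⌋ ℕ.* suc ⌊√ n ⌋ ℕ.≤ᵇ suc n in eq
... | true  = ℕ.≤ᵇ⇒≤ (suc ⌊√ n ⌋ ℕ.* suc ⌊√ n ⌋) (suc n) (subst T (sym eq) _)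
            , ℕ.≤-<-trans (proj₂ (⌊√⌋-spec n))
                (ℕ.*-mono-< (ℕ.n<1+n (suc ⌊√ n ⌋)) (ℕ.n<1+n (suc ⌊√ n ⌋)))
... | false = ℕ.≤-trans (proj₁ (⌊√⌋-spec n)) (ℕ.n≤1+n n)
            , ℕ.≰⇒> (λ le → subst T eq (ℕ.≤⇒≤ᵇ le))

ι : ℕ → ℚ
ι n = + n ℚ./ 1

/≃ : ∀ k d → ℚ.toℚᵘ (+ k ℚ./ suc d) ℚᵘ.≃ ℚᵘ.mkℚᵘ (+ k) d
/≃ k d = ℚ.toℚᵘ-fromℚᵘ (ℚᵘ.mkℚᵘ (+ k) d)

ι-≤ : ∀ {m n} → m ℕ.≤ n → ι m ℚ.≤ ι n
ι-≤ {m} {n} m≤n = ℚ.toℚᵘ-cancel-≤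
  (ℚᵘ.≤-trans (ℚᵘ.≤-reflexive (/≃ m 0))
    (ℚᵘ.≤-trans (ℚᵘ.*≤* (ℤ.*-monoʳ-≤-nonNeg (+ 1) (ℤ.+≤+ m≤n)))
      (ℚᵘ.≤-reflexive (ℚᵘ.≃-sym (/≃ n 0)))))

ι-< : ∀ {m n} → m ℕ.< n → ι m ℚ.< ι n
ι-< {m} {n} m<n = ℚ.toℚᵘ-cancel-<
  (ℚᵘ.≤-<-trans (ℚᵘ.≤-reflexive (/≃ m 0))
    (ℚᵘ.<-≤-trans (ℚᵘ.*<* (ℤ.*-monoʳ-<-pos (+ 1) (ℤ.+<+ m<n)))
      (ℚᵘ.≤-reflexive (ℚᵘ.≃-sym (/≃ n 0)))))

*-ι : ∀ p k d → ℚ.toℚᵘ p ℚᵘ.≃ ℚᵘ.mkℚᵘ (+ k) d → p ℚ.* ι (suc d) ≡ ι k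
*-ι p k d p≃ = ℚ.toℚᵘ-injective
  (ℚᵘ.≃-trans (ℚ.toℚᵘ-homo-* p (ι (suc d)))
    (ℚᵘ.≃-trans (ℚᵘ.*-cong p≃ (/≃ (suc d) 0))
      (ℚᵘ.≃-trans (ℚᵘ.*≡* cross) (ℚᵘ.≃-sym (/≃ k 0)))))
  where
  cross : (+ k ℤ.* + suc d) ℤ.* + 1 ≡ + k ℤ.* + suc (d ℕ.* 1)
  cross = trans (ℤ.*-identityʳ (+ k ℤ.* + suc d))
    (cong (λ e → + k ℤ.* + suc e) (sym (ℕ.*-identityʳ d)))

∣∣≃ : ∀ q → ℚ.toℚᵘ ℚ.∣ q ∣ ℚᵘ.≃ ℚᵘ.mkℚᵘ (+ ℤ.∣ ℚ.↥ q ∣) (ℚ.ℚ.denominator-1 q)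
∣∣≃ (ℚ.mkℚ _ _ _) = ℚᵘ.≃-refl

ι-* : ∀ m n → ι (m ℕ.* n) ≡ ι m ℚ.* ι n
ι-* m n = ℚ.toℚᵘ-injective
  (ℚᵘ.≃-trans (/≃ (m ℕ.* n) 0)
    (ℚᵘ.≃-sym (ℚᵘ.≃-trans (ℚ.toℚᵘ-homo-* (ι m) (ι n))
      (ℚᵘ.≃-trans (ℚᵘ.*-cong (/≃ m 0) (/≃ n 0))
        (ℚᵘ.*≡* (cong (ℤ._* + 1) (sym (ℤ.pos-* m n))))))))

ι-suc : ∀ n → ι (suc n) ≡ ι n ℚ.+ 1ℚ
ι-suc n = ℚ.toℚᵘ-injective
  (ℚᵘ.≃-trans (/≃ (suc n) 0)
    (ℚᵘ.≃-sym (ℚᵘ.≃-trans (ℚ.toℚᵘ-homo-+ (ι n) 1ℚ)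
      (ℚᵘ.≃-trans (ℚᵘ.+-congˡ (ℚ.toℚᵘ 1ℚ) (/≃ n 0))
        (ℚᵘ.*≡* (cong (ℤ._* + 1) eq))))))
  where
  eq : (+ n ℤ.* + 1) ℤ.+ + 1 ≡ + suc n
  eq = trans (cong (ℤ._+ + 1) (ℤ.*-identityʳ (+ n))) (cong +_ (ℕ.+-comm n 1))

archimedean : ∀ {η} → 0ℚ ℚ.< η → ∃[ k ] ∀ n → k ℕ.≤ n → 1ℚ ℚ.≤ η ℚ.* ι (suc n)
archimedean {ℚ.mkℚ (+ zero) d c} 0<η = contradiction (ℚ.drop-*<* 0<η) λ { (ℤ.+<+ ()) }
archimedean {ℚ.mkℚ ℤ.-[1+ _ ] d c} 0<η = contradiction (ℚ.drop-*<* 0<η) λ ()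
archimedean {η@(ℚ.mkℚ (+ suc a) d c)} 0<η = suc d , λ n d<n →
  ℚ.≤-trans (ι-≤ {1} {suc a} (ℕ.s≤s ℕ.z≤n))
    (ℚ.≤-trans (ℚ.≤-reflexive (sym (*-ι η (suc a) d ℚᵘ.≃-refl)))
      (ℚ.*-monoˡ-≤-nonNeg η {ι (suc d)} {ι (suc n)} (ι-≤ (ℕ.m≤n⇒m≤1+n d<n))))

ι-pos : ∀ n → ℚ.Positive (ι (suc n))
ι-pos n = ℚ.positive (ι-< {0} {suc n} (ℕ.s≤s ℕ.z≤n))

sq-mono-≤ : ∀ {p q} → 0ℚ ℚ.≤ p → p ℚ.≤ q → p ℚ.* p ℚ.≤ q ℚ.* q
sq-mono-≤ {p} {q} 0≤p p≤q = ℚ.≤-trans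
  (ℚ.*-monoˡ-≤-nonNeg p {{ℚ.nonNegative 0≤p}} {p} {q} p≤q)
  (ℚ.*-monoʳ-≤-nonNeg q {{ℚ.nonNegative (ℚ.≤-trans 0≤p p≤q)}} {p} {q} p≤q)

-- √≈ q n is the largest multiple of 1/(b(n+1)) whose square is at most ∣ q ∣,
-- where b is the denominator of q.
√≈ : ℚ → ℕ → ℚ
√≈ q n = + ⌊√ ℤ.∣ ℚ.↥ q ∣ ℕ.* ℚ.↧ₙ q ℕ.* (suc n ℕ.* suc n) ⌋ ℚ./ (ℚ.↧ₙ q ℕ.* suc n)

module _ (q : ℚ) (n : ℕ) where

  private
    a b k : ℕ
    a = ℤ.∣ ℚ.↥ q ∣
    b = ℚ.ℚ.denominator-1 q
    k = ⌊√ a ℕ.* suc b ℕ.* (suc n ℕ.* suc n) ⌋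

    s A D : ℚ
    s = √≈ q n
    A = ℚ.∣ q ∣
    D = ι (suc b ℕ.* suc n)

    instance
      D-pos : ℚ.Positive D
      D-pos = ι-pos (n ℕ.+ b ℕ.* suc n)
      D-nonNeg : ℚ.NonNegative D
      D-nonNeg = ℚ.pos⇒nonNeg D
      DD-pos : ℚ.Positive (D ℚ.* D)
      DD-pos = ℚ.pos*pos⇒pos D D
      DD-nonNeg : ℚ.NonNegative (D ℚ.* D)
      DD-nonNeg = ℚ.pos⇒nonNeg (D ℚ.* D)

    sD : s ℚ.* D ≡ ι k
    sD = *-ι s k (n ℕ.+ b ℕ.* suc n) (/≃ k (n ℕ.+ b ℕ.* suc n))

    ssDD : (s ℚ.* s) ℚ.* (D ℚ.* D) ≡ ι (k ℕ.* k)
    ssDD = begin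
      (s ℚ.* s) ℚ.* (D ℚ.* D)  ≡⟨ solve 2 (λ s d → (s :* s) :* (d :* d) := (s :* d) :* (s :* d)) refl s D ⟩
      (s ℚ.* D) ℚ.* (s ℚ.* D)  ≡⟨ cong₂ ℚ._*_ sD sD ⟩
      ι k ℚ.* ι k              ≡⟨ ι-* k k ⟨
      ι (k ℕ.* k)              ∎
      where open ≡-Reasoning

    ADD : A ℚ.* (D ℚ.* D) ≡ ι (a ℕ.* suc b ℕ.* (suc n ℕ.* suc n))
    ADD = begin
      A ℚ.* (D ℚ.* D)
        ≡⟨ cong (λ d → A ℚ.* (d ℚ.* d)) (ι-* (suc b) (suc n)) ⟩
      A ℚ.* ((B ℚ.* N) ℚ.* (B ℚ.* N))
        ≡⟨ solve 3 (λ a b n → a :* ((b :* n) :* (b :* n)) := ((a :* b) :* b) :* (n :* n)) refl A B N ⟩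
      ((A ℚ.* B) ℚ.* B) ℚ.* (N ℚ.* N)
        ≡⟨ cong (λ x → (x ℚ.* B) ℚ.* (N ℚ.* N)) (*-ι A a b (∣∣≃ q)) ⟩
      (ι a ℚ.* B) ℚ.* (N ℚ.* N)
        ≡⟨ cong₂ ℚ._*_ (ι-* a (suc b)) (ι-* (suc n) (suc n)) ⟨
      ι (a ℕ.* suc b) ℚ.* ι (suc n ℕ.* suc n)
        ≡⟨ ι-* (a ℕ.* suc b) (suc n ℕ.* suc n) ⟨
      ι (a ℕ.* suc b ℕ.* (suc n ℕ.* suc n)) ∎
      where
      open ≡-Reasoning
      B N : ℚ
      B = ι (suc b)
      N = ι (suc n)

  0≤√≈ : 0ℚ ℚ.≤ √≈ q n
  0≤√≈ = ℚ.*-cancelʳ-≤-pos {0ℚ} {s} D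
    (subst₂ ℚ._≤_ (sym (ℚ.*-zeroˡ D)) (sym sD) (ι-≤ {0} {k} ℕ.z≤n))

  √≈-lower : √≈ q n ℚ.* √≈ q n ℚ.≤ ℚ.∣ q ∣
  √≈-lower = ℚ.*-cancelʳ-≤-pos {s ℚ.* s} {A} (D ℚ.* D)
    (subst₂ ℚ._≤_ (sym ssDD) (sym ADD)
      (ι-≤ (proj₁ (⌊√⌋-spec (a ℕ.* suc b ℕ.* (suc n ℕ.* suc n))))))

  √≈-upper : ∀ {η} → 0ℚ ℚ.< η → 1ℚ ℚ.≤ η ℚ.* ι (suc n) →
    ℚ.∣ q ∣ ℚ.< (√≈ q n ℚ.+ η) ℚ.* (√≈ q n ℚ.+ η)
  √≈-upper {η} 0<η 1≤ = ℚ.*-cancelʳ-<-nonNeg (D ℚ.* D) {A} {(s ℚ.+ η) ℚ.* (s ℚ.+ η)}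
    (begin-strict
      A ℚ.* (D ℚ.* D)
        ≡⟨ ADD ⟩
      ι (a ℕ.* suc b ℕ.* (suc n ℕ.* suc n))
        <⟨ ι-< (proj₂ (⌊√⌋-spec (a ℕ.* suc b ℕ.* (suc n ℕ.* suc n)))) ⟩
      ι (suc k ℕ.* suc k)
        ≡⟨ ι-* (suc k) (suc k) ⟩
      ι (suc k) ℚ.* ι (suc k)
        ≤⟨ sq-mono-≤ {ι (suc k)} {(s ℚ.+ η) ℚ.* D} (ι-≤ {0} {suc k} ℕ.z≤n) step ⟩
      ((s ℚ.+ η) ℚ.* D) ℚ.* ((s ℚ.+ η) ℚ.* D)
        ≡⟨ solve 2 (λ s d → (s :* d) :* (s :* d) := (s :* s) :* (d :* d)) refl (s ℚ.+ η) D ⟩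
      ((s ℚ.+ η) ℚ.* (s ℚ.+ η)) ℚ.* (D ℚ.* D) ∎)
    where
    open ℚ.≤-Reasoning
    N≤D : ι (suc n) ℚ.≤ D
    N≤D = ι-≤ (ℕ.m≤m+n (suc n) (b ℕ.* suc n))
    step : ι (suc k) ℚ.≤ (s ℚ.+ η) ℚ.* D
    step = begin
      ι (suc k)              ≡⟨ ι-suc k ⟩
      ι k ℚ.+ 1ℚ             ≤⟨ ℚ.+-monoʳ-≤ (ι k) {1ℚ} {η ℚ.* D}
                                  (ℚ.≤-trans 1≤ (ℚ.*-monoˡ-≤-nonNeg η
                                    {{ℚ.nonNegative (ℚ.<⇒≤ 0<η)}} {ι (suc n)} {D} N≤D)) ⟩
      ι k ℚ.+ η ℚ.* D        ≡⟨ cong (ℚ._+ η ℚ.* D) sD ⟨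
      s ℚ.* D ℚ.+ η ℚ.* D    ≡⟨ ℚ.*-distribʳ-+ D s η ⟨
      (s ℚ.+ η) ℚ.* D        ∎

∣p-q∣<ε : ∀ {p q ε} → p ℚ.- q ℚ.< ε → q ℚ.- p ℚ.< ε → ℚ.∣ p ℚ.- q ∣ ℚ.< ε
∣p-q∣<ε {p} {q} {ε} p-q<ε q-p<ε = go (ℚ.∣p∣≡p∨∣p∣≡-p (p ℚ.- q))
  where
  go : ℚ.∣ p ℚ.- q ∣ ≡ p ℚ.- q ⊎ ℚ.∣ p ℚ.- q ∣ ≡ ℚ.- (p ℚ.- q) → ℚ.∣ p ℚ.- q ∣ ℚ.< ε
  go (inj₁ eq) = subst (ℚ._< ε) (sym eq) p-q<ε
  go (inj₂ eq) = subst (ℚ._< ε)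
    (sym (trans eq (solve 2 (λ p q → :- (p :- q) := q :- p) refl p q))) q-p<ε

√≈-close : ∀ p q m n {η} → 0ℚ ℚ.< η →
  ℚ.∣ p ℚ.- q ∣ ℚ.< η ℚ.* η → 1ℚ ℚ.≤ η ℚ.* ι (suc n) →
  √≈ p m ℚ.- √≈ q n ℚ.< η ℚ.+ η
√≈-close p q m n {η} 0<η p~q 1≤ = ℚ.≰⇒> λ η+η≤s-t → ℚ.<-irrefl refl (begin-strict
    ℚ.∣ p ∣
      ≡⟨ cong ℚ.∣_∣ (solve 2 (λ p q → p := (p :- q) :+ q) refl p q) ⟩
    ℚ.∣ (p ℚ.- q) ℚ.+ q ∣
      ≤⟨ ℚ.∣p+q∣≤∣p∣+∣q∣ (p ℚ.- q) q ⟩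
    ℚ.∣ p ℚ.- q ∣ ℚ.+ ℚ.∣ q ∣
      <⟨ ℚ.+-mono-< {ℚ.∣ p ℚ.- q ∣} {η ℚ.* η} {ℚ.∣ q ∣} {(t ℚ.+ η) ℚ.* (t ℚ.+ η)}
           p~q (√≈-upper q n 0<η 1≤) ⟩
    η ℚ.* η ℚ.+ (t ℚ.+ η) ℚ.* (t ℚ.+ η)
      ≡⟨ ℚ.+-identityʳ _ ⟨
    η ℚ.* η ℚ.+ (t ℚ.+ η) ℚ.* (t ℚ.+ η) ℚ.+ 0ℚ
      ≤⟨ ℚ.+-monoʳ-≤ (η ℚ.* η ℚ.+ (t ℚ.+ η) ℚ.* (t ℚ.+ η)) {0ℚ} {x ℚ.+ x}
           (ℚ.+-mono-≤ {0ℚ} {x} {0ℚ} {x} 0≤x 0≤x) ⟩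
    η ℚ.* η ℚ.+ (t ℚ.+ η) ℚ.* (t ℚ.+ η) ℚ.+ (x ℚ.+ x)
      ≡⟨ solve 2 (λ h t → h :* h :+ (t :+ h) :* (t :+ h) :+ (h :* (t :+ h) :+ h :* (t :+ h))
                       := ((h :+ h) :+ t) :* ((h :+ h) :+ t)) refl η t ⟩
    ((η ℚ.+ η) ℚ.+ t) ℚ.* ((η ℚ.+ η) ℚ.+ t)
      ≤⟨ sq-mono-≤ {(η ℚ.+ η) ℚ.+ t} {s} 0≤2η+t
           (ℚ.≤-trans (ℚ.+-monoˡ-≤ t {η ℚ.+ η} {s ℚ.- t} η+η≤s-t)
             (ℚ.≤-reflexive (solve 2 (λ s t → (s :- t) :+ t := s) refl s t))) ⟩
    s ℚ.* s
      ≤⟨ √≈-lower p m ⟩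
    ℚ.∣ p ∣ ∎)
  where
  open ℚ.≤-Reasoning
  s t x : ℚ
  s = √≈ p m
  t = √≈ q n
  x = η ℚ.* (t ℚ.+ η)
  0≤η : 0ℚ ℚ.≤ η
  0≤η = ℚ.<⇒≤ 0<η
  0≤t+η : 0ℚ ℚ.≤ t ℚ.+ η
  0≤t+η = ℚ.+-mono-≤ {0ℚ} {t} {0ℚ} {η} (0≤√≈ q n) 0≤η
  0≤x : 0ℚ ℚ.≤ x
  0≤x = ℚ.nonNegative⁻¹ x
    {{ℚ.nonNeg*nonNeg⇒nonNeg η {{ℚ.nonNegative 0≤η}} (t ℚ.+ η) {{ℚ.nonNegative 0≤t+η}}}}
  0≤2η+t : 0ℚ ℚ.≤ (η ℚ.+ η) ℚ.+ t
  0≤2η+t = ℚ.+-mono-≤ {0ℚ} {η ℚ.+ η} {0ℚ} {t}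
    (ℚ.+-mono-≤ {0ℚ} {η} {0ℚ} {η} 0≤η 0≤η) (0≤√≈ q n)

opaque

  √-isCauchy : ∀ f → IsCauchy f → IsCauchy (λ n → √≈ (f n) n)
  √-isCauchy f cf ε 0<ε = N , λ m n N≤m N≤n →
      ∣p-q∣<ε {√≈ (f m) m} {√≈ (f n) n}
        (subst (√≈ (f m) m ℚ.- √≈ (f n) n ℚ.<_) η+η≡ε
          (√≈-close (f m) (f n) m n 0<η
            (proj₂ (cf (η ℚ.* η) 0<ηη) m n (ℕ.≤-trans N₁≤N N≤m) (ℕ.≤-trans N₁≤N N≤n))
            (proj₂ (archimedean 0<η) n (ℕ.≤-trans N₂≤N N≤n))))
        (subst (√≈ (f n) n ℚ.- √≈ (f m) m ℚ.<_) η+η≡ε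
          (√≈-close (f n) (f m) n m 0<η
            (proj₂ (cf (η ℚ.* η) 0<ηη) n m (ℕ.≤-trans N₁≤N N≤n) (ℕ.≤-trans N₁≤N N≤m))
            (proj₂ (archimedean 0<η) m (ℕ.≤-trans N₂≤N N≤m))))
    where
    η : ℚ
    η = proj₁ (split 0<1 0<ε)
    0<η : 0ℚ ℚ.< η
    0<η = proj₁ (proj₂ (split 0<1 0<ε))
    η+η≡ε : η ℚ.+ η ≡ ε
    η+η≡ε = trans (sym (ℚ.*-identityˡ (η ℚ.+ η))) (proj₂ (proj₂ (split 0<1 0<ε)))
    0<ηη : 0ℚ ℚ.< η ℚ.* η
    0<ηη = ℚ.positive⁻¹ (η ℚ.* η) {{ℚ.pos*pos⇒pos η {{ℚ.positive 0<η}} η {{ℚ.positive 0<η}}}}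
    N₁ N₂ N : ℕ
    N₁ = proj₁ (cf (η ℚ.* η) 0<ηη)
    N₂ = proj₁ (archimedean 0<η)
    N = N₁ ℕ.+ N₂
    N₁≤N : N₁ ℕ.≤ N
    N₁≤N = ℕ.m≤m+n N₁ N₂
    N₂≤N : N₂ ℕ.≤ N
    N₂≤N = ℕ.m≤n+m N₂ N₁

record ℝ : Set where
  constructor mkℝ
  field
    seq    : ℕ → ℚ
    cauchy : IsCauchy seq

open ℝ public

infix 4 _≈ᴿ_ _<ᴿ_ _≤ᴿ_

record _≈ᴿ_ (x y : ℝ) : Set where
  constructor mk≈
  field
    close : ∀ ε → 0ℚ ℚ.< ε →
      ∃[ N ] ∀ n → N ℕ.≤ n → ℚ.∣ seq x n ℚ.- seq y n ∣ ℚ.< ε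

record _<ᴿ_ (x y : ℝ) : Set where
  constructor mk<
  field
    gap   : ℚ
    0<gap : 0ℚ ℚ.< gap
    from  : ℕ
    apart : ∀ n → from ℕ.≤ n → seq x n ℚ.+ gap ℚ.< seq y n

_≤ᴿ_ : ℝ → ℝ → Set
x ≤ᴿ y = ¬ (y <ᴿ x)

fromℚ : ℚ → ℝ
fromℚ q = mkℝ (λ _ → q) (const-isCauchy q)

fromℤ : ℤ → ℝ
fromℤ i = fromℚ (i ℚ./ 1)

ℝ-rawRing : RawRing 0ℓ 0ℓ
ℝ-rawRing = record
  { Carrier = ℝ
  ; _≈_     = _≈ᴿ_
  ; _+_     = λ x y → mkℝ (λ n → seq x n ℚ.+ seq y n) (+-isCauchy (seq x) (seq y) (cauchy x) (cauchy y))
  ; _*_     = λ x y → mkℝ (λ n → seq x n ℚ.* seq y n) (*-isCauchy (seq x) (seq y) (cauchy x) (cauchy y))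
  ; -_      = λ x → mkℝ (λ n → ℚ.- seq x n) (neg-isCauchy (seq x) (cauchy x))
  ; 0#      = fromℚ 0ℚ
  ; 1#      = fromℚ 1ℚ
  }

module ℝ-Ring = RawRing ℝ-rawRing

infixl 6 _-ᴿ_

_-ᴿ_ : ℝ → ℝ → ℝ
x -ᴿ y = let open ℝ-Ring in x + (- y)

recip : (x : ℝ) → ℝ-Ring.0# <ᴿ x → ℝ
recip x (mk< ε 0<ε N 0+ε<x) =
  mkℝ (1/-seq f cf 0<ε ε<f) (1/-isCauchy f cf 0<ε ε<f)
  where
  f : ℕ → ℚ
  f n = seq x (N ℕ.+ n)
  cf : IsCauchy f
  cf = shift-isCauchy (seq x) N (cauchy x)
  ε<f : ∀ n → ε ℚ.< f n
  ε<f n = subst (ℚ._< f n) (ℚ.+-identityˡ ε) (0+ε<x (N ℕ.+ n) (ℕ.m≤m+n N n))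

-- The square root of the absolute value.
√ : ℝ → ℝ
√ x = mkℝ (λ n → √≈ (seq x n) n) (√-isCauchy (seq x) (cauchy x))

record ℂ : Set where
  constructor _+i_
  field
    re im : ℝ

open ℂ public

infix 4 _≈ᶜ_

record _≈ᶜ_ (z w : ℂ) : Set where
  constructor mk≈ᶜ
  field
    re≈ : re z ≈ᴿ re w
    im≈ : im z ≈ᴿ im w

ℂ-rawRing : RawRing 0ℓ 0ℓ
ℂ-rawRing = record
  { Carrier = ℂ
  ; _≈_     = _≈ᶜ_
  ; _+_     = λ z w → (re z + re w) +i (im z + im w)
  ; _*_     = λ z w → (re z * re w -ᴿ im z * im w) +i (re z * im w + im z * re w)
  ; -_      = λ z → (- re z) +i (- im z)
  ; 0#      = 0# +i 0#
  ; 1#      = 1# +i 0#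
  }
  where open ℝ-Ring

fromℝ : ℝ → ℂ
fromℝ x = x +i ℝ-Ring.0#

∣_∣ : ℂ → ℝ
∣ z ∣ = let open ℝ-Ring in √ (re z * re z + im z * im z)

open RawRing ℂ-rawRing public using (_≈_; _+_; _*_; -_; 0#; 1#)
open import Algebra.Definitions.RawSemiring (RawRing.rawSemiring ℂ-rawRing)
  public using (_^_; sum)

infixl 6 _-_

_-_ : ℂ → ℂ → ℂ
z - w = z + (- w)

infixl 10 ∑-syntax

∑-syntax : ∀ n → (Fin n → ℂ) → ℂ
∑-syntax _ = sum

syntax ∑-syntax n (λ i → z) = ∑[ i < n ] z

-- The graph of the floor function, which is not computable on Cauchy reals.
Floor : ℝ → ℤ → Set
Floor x k = fromℤ k ≤ᴿ x × x <ᴿ fromℤ k ℝ-Ring.+ ℝ-Ring.1#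

module Expansion (β : ℝ) (1<β : ℝ-Ring.1# <ᴿ β) where

  private module R = ℝ-Ring

  0<β+1 : R.0# <ᴿ β R.+ R.1#
  0<β+1 = mk< gap 0<gap from λ n from≤n → 0+ε<x+1 gap (seq β n) (apart n from≤n)
    where
    open _<ᴿ_ 1<β
    0+ε<x+1 : ∀ ε x → 1ℚ ℚ.+ ε ℚ.< x → 0ℚ ℚ.+ ε ℚ.< x ℚ.+ 1ℚ
    0+ε<x+1 ε x 1+ε<x = begin-strict
      0ℚ ℚ.+ ε  <⟨ ℚ.+-monoˡ-< ε {0ℚ} {1ℚ} 0<1 ⟩
      1ℚ ℚ.+ ε  <⟨ 1+ε<x ⟩
      x         ≡⟨ ℚ.+-identityʳ x ⟨
      x ℚ.+ 0ℚ  <⟨ ℚ.+-monoʳ-< x {0ℚ} {1ℚ} 0<1 ⟩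
      x ℚ.+ 1ℚ  ∎
      where open ℚ.≤-Reasoning

  l : ℝ
  l = R.- (β R.* recip (β R.+ R.1#) 0<β+1)

  r : ℝ
  r = recip (β R.+ R.1#) 0<β+1

  record I (x : ℝ) : Set where
    field
      lower : l ≤ᴿ x
      upper : x <ᴿ r

  -- The graph of T, together with the digit k = ⌊ - β x - l ⌋.
  record Step (x : ℝ) (k : ℤ) (y : ℝ) : Set where
    field
      digit : Floor (((R.- β) R.* x) -ᴿ l) k
      image : y ≈ᴿ ((R.- β) R.* x) -ᴿ fromℤ k

  -- Digits are indexed from 0: d i is the digit usually written x_{i+1}.
  record IsExpansion (x : ℝ) (d : ℕ → ℤ) : Set where
    field
      domain : I x
      orbit  : ℕ → ℝ
      start  : orbit 0 ≈ᴿ x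
      step   : ∀ i → Step (orbit i) (d i) (orbit (suc i))

-- d = d₁ ⋯ dₘ (dₘ₊₁ ⋯ dₘ₊ₚ)^ω
record IsPeriodicForm (d : ℕ → ℤ) (m p : ℕ) : Set where
  field
    1≤p      : 1 ℕ.≤ p
    periodic : ∀ i → m ℕ.≤ i → d (i ℕ.+ p) ≡ d i

record IsMinimalForm (d : ℕ → ℤ) (m p : ℕ) : Set where
  field
    form    : IsPeriodicForm d m p
    minimal : ∀ m′ p′ → IsPeriodicForm d m′ p′ → m ℕ.≤ m′ × p ℕ.≤ p′

IsItoSadahiro : (β : ℝ) → ℝ-Ring.1# <ᴿ β → Set
IsItoSadahiro β 1<β =
  ∃[ d ] IsExpansion l d × ∃[ m ] ∃[ p ] IsPeriodicForm d m p
  where open Expansion β 1<β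

-- With i counted from 0, the exponent m - (i + 1) is m ∸ suc i.
itoSadahiroPolynomial : (d : ℕ → ℤ) (m p : ℕ) → ℂ → ℂ
itoSadahiroPolynomial d m p x =
    (- x) ^ suc m * ∑[ i < p ] ((- x) ^ toℕ i)
  + ((- x) ^ p - 1#) * ∑[ i < m ] (digit (toℕ i) * (- x) ^ (m ∸ suc (toℕ i)))
  + ∑[ i < p ] (digit (m ℕ.+ toℕ i) * (- x) ^ (p ∸ suc (toℕ i)))
  where
  digit : ℕ → ℂ
  digit i = fromℝ (fromℤ (d i))

-- The value at z of the monic polynomial xⁿ + aₙ₋₁ xⁿ⁻¹ + ⋯ + a₀ over ℚ.
evalMonic : ∀ n → Vector ℚ n → ℂ → ℂ
evalMonic n a z = z ^ n + ∑[ i < n ] (fromℝ (fromℚ (a i)) * z ^ toℕ i)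

IsMinimalPolynomial : ℂ → (n : ℕ) → Vector ℚ n → Set
IsMinimalPolynomial z n a =
  evalMonic n a z ≈ 0# × (∀ k (b : Vector ℚ k) → evalMonic k b z ≈ 0# → n ℕ.≤ k)

_IsConjugateOf_ : ℂ → ℂ → Set
w IsConjugateOf z =
  ∃[ n ] Σ[ a ∈ Vector ℚ n ] IsMinimalPolynomial z n a × evalMonic n a w ≈ 0#

module Submission where

-- Let t be the orbit of l under T, put y = -γ, r = l + 1 and uₙ = r - tₙ, so that
-- uₙ ∈ [0, 1] and u₀ = 1, and let U₀ = 0, Uₙ₊₁ = y Uₙ + uₙ.  Since tₘ₊ₚ = tₘ and
-- l = -β r, the Ito-Sadahiro polynomial factors as P(γ) = (y + β) (Uₘ₊ₚ - Uₘ), so a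
-- root γ ≠ β makes U periodic from index m on.  But if ∣y∣² ≥ 7/2, then
-- ∣U₃∣² = ∣y² + u₁ y + u₂∣² ≥ 36/25, and from there on ∣Uₙ₊₁∣² ≥ ∣Uₙ∣² + 2/25.
-- As 7/2 < 4, this refutes ∣γ∣ ≥ 2 with room to spare, which gives the strict
-- inequality constructively.  Conjugates of β are roots of P because every
-- rational polynomial that vanishes at β vanishes at its conjugates.

open import Algebra.Bundles using (CommutativeRing)
open import Algebra.Bundles.Raw using (RawRing)
import Algebra.Consequences.Setoid as Consequences
open import Algebra.Definitions using (Commutative; Congruent₂)
import Algebra.Definitions.RawSemiring
open import Algebra.Morphism.Structures using (IsRingHomomorphism)
import Algebra.Properties.Semiring.Exp
import Algebra.Properties.Semiring.Sum
open import Algebra.Solver.Ring.AlmostCommutativeRing using (fromCommutativeRing; _-Raw-AlmostCommutative⟶_)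
import Algebra.Solver.Ring as RingSolver
open import Data.Fin.Base as Fin using (Fin; toℕ)
open import Data.Integer.Base as ℤ using (ℤ; +_)
open import Data.List.Base using (List; []; _∷_; _∷ʳ_; length; map; tabulate; lookup; replicate; _++_; initLast; _∷ʳ′_)
import Data.List.Properties as List
import Data.Maybe.Base as Maybe
open import Data.Nat.Base as ℕ using (ℕ; zero; suc; _∸_)
import Data.Nat.Properties as ℕ
open import Data.Product.Base using (_×_; _,_; proj₁; proj₂; ∃-syntax)
open import Data.Rational.Base as ℚ using (ℚ; 0ℚ; 1ℚ)
import Data.Rational.Properties as ℚ
open import Data.Rational.Solver using (module +-*-Solver)
open import Data.Sum.Base using (_⊎_; inj₁; inj₂)
open import Data.Vec.Functional using (Vector)
open import Defs hiding (_≈_; _+_; _*_; -_; _-_; 0#; 1#; _^_; sum)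
open import Level using (0ℓ)
open import Relation.Binary.Bundles using (Setoid)
open import Relation.Binary.Definitions using (Reflexive; Symmetric; Transitive)
open import Relation.Binary.PropositionalEquality as ≡ using (_≡_)
import Relation.Binary.Reasoning.Setoid
open import Relation.Binary.Structures using (IsEquivalence)
open import Relation.Nullary using (¬_; Dec; yes; no)
open import Relation.Nullary.Decidable using (toWitness)
open import Relation.Nullary.Decidable.Core using (dec⇒maybe)
open import Relation.Nullary.Negation using (contradiction)

-- The obstacle is the start of the growth. At ∣y∣ = 2 the triangle inequality gives ∣Uₙ₊₁∣ ≥ 2∣Uₙ∣
-- - 1, which has the fixed point 1, and U₁ = 1 sits exactly on it. U₂ = y + u₁ can have modulus 1
-- again (y = -2, u₁ = 1), and for U₃ the triangle inequality still yields only 4 - 2 - 1 = 1. What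
-- saves U₃ is that u₁ and u₂ are real and lie in [0, 1], so they cannot pull against y² in
-- arbitrary directions. The growth estimate needs ∣Uₙ∣² > 4/3, and 36/25 = (6/5)² is a convenient
-- square above that. The factor y + β appears because Uₙ is a quotient by y + β of a polynomial
-- that vanishes at y = -β, where the digits and the orbit cancel. Constructively, γ ≠ β is only a
-- negation and gives no lower bound on ∣γ - β∣, so the factor cannot be divided out. Cancellation
-- is instead done on statements of the form "nonnegative", which are stable under double negation.

p≤q⇒0≤q-p : ∀ {p q} → p ℚ.≤ q → 0ℚ ℚ.≤ q ℚ.- p
p≤q⇒0≤q-p {p} {q} p≤q = ≡.subst (ℚ._≤ q ℚ.- p) (ℚ.+-inverseʳ p) (ℚ.+-monoˡ-≤ (ℚ.- p) p≤q)

-- Algebras over the rationals and their order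

record ℚ-Algebra : Set₁ where
  field
    commutativeRing : CommutativeRing 0ℓ 0ℓ

  open CommutativeRing commutativeRing public

  field
    embed              : ℚ → Carrier
    isRingHomomorphism : IsRingHomomorphism ℚ.+-*-rawRing rawRing embed

  open IsRingHomomorphism isRingHomomorphism public
    using (+-homo; *-homo; -‿homo; 0#-homo; 1#-homo)

  private
    morphism : ℚ.+-*-rawRing -Raw-AlmostCommutative⟶ fromCommutativeRing commutativeRing
    morphism = record
      { ⟦_⟧    = embed
      ; +-homo = +-homo
      ; *-homo = *-homo
      ; -‿homo = -‿homo
      ; 0-homo = 0#-homo
      ; 1-homo = 1#-homo
      }

  -- Rational coefficients have decidable equality, so identities with constants such as 17/40 are
  -- settled by normalisation. The abstract carrier keeps Cauchy sequences out of the normalised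
  -- terms and serves ℝ and ℂ alike.
  module Solver = RingSolver ℚ.+-*-rawRing (fromCommutativeRing commutativeRing) morphism
    (λ p q → Maybe.map (λ p≡q → reflexive (≡.cong embed p≡q)) (dec⇒maybe (p ℚ.≟ q)))

-- The order is given by its nonnegative elements.  As x ≤ y on the reals means
-- ¬ (y < x), nonNeg-stable holds constructively.
record OrderedℚAlgebra : Set₁ where
  field
    algebra : ℚ-Algebra

  open ℚ-Algebra algebra public

  field
    NonNeg        : Carrier → Set
    nonNeg-resp   : ∀ {x y} → x ≈ y → NonNeg x → NonNeg y
    nonNeg-+      : ∀ {x y} → NonNeg x → NonNeg y → NonNeg (x + y)
    nonNeg-*      : ∀ {x y} → NonNeg x → NonNeg y → NonNeg (x * y)
    nonNeg-sq     : ∀ x → NonNeg (x * x)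
    nonNeg-embed  : ∀ {q} → 0ℚ ℚ.≤ q → NonNeg (embed q)
    embed-nonNeg  : ∀ {q} → NonNeg (embed q) → 0ℚ ℚ.≤ q
    nonNeg-stable : ∀ {x} → (∀ g → 0ℚ ℚ.< g → ¬ NonNeg (- x - embed g)) → NonNeg x
    nonNeg-antisym : ∀ {x} → NonNeg x → NonNeg (- x) → x ≈ 0#

-- Order arguments without division, and the two norm estimates

module OrderedℚAlgebraProperties (A : OrderedℚAlgebra) where

  open OrderedℚAlgebra A
  open Solver using (solve; _:+_; _:*_; _:-_; :-_; _:=_; con)
  open Relation.Binary.Reasoning.Setoid setoid

  ⅛ ¼ ½ 2ℚ ¾ 6/5 ⅞ 17/40 69/80 2/25 36/25 7/2 : ℚ
  ⅛     = + 1 ℚ./ 8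
  ¼     = + 1 ℚ./ 4
  ½     = + 1 ℚ./ 2
  2ℚ    = + 2 ℚ./ 1
  ¾     = + 3 ℚ./ 4
  6/5   = + 6 ℚ./ 5
  ⅞     = + 7 ℚ./ 8
  17/40 = + 17 ℚ./ 40
  69/80 = + 69 ℚ./ 80
  2/25  = + 2 ℚ./ 25
  36/25 = + 36 ℚ./ 25
  7/2   = + 7 ℚ./ 2

  nonNeg-const : ∀ q {{_ : ℚ.NonNegative q}} → NonNeg (embed q)
  nonNeg-const q = nonNeg-embed (ℚ.nonNegative⁻¹ q)

  ¬nonNeg-neg-embed : ∀ {q} → 0ℚ ℚ.< q → ¬ NonNeg (- embed q)
  ¬nonNeg-neg-embed {q} 0<q -q≥0 = ℚ.<-irrefl ≡.refl
    (ℚ.<-≤-trans (ℚ.neg-antimono-< 0<q) (embed-nonNeg (nonNeg-resp (sym (-‿homo q)) -q≥0)))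

  -- Cancellation without a reciprocal: if x ≤ -g with a rational g > 0, then x w ≤ -g c < 0,
  -- against x w ≥ 0. Stability turns this refutation into a proof.
  nonNeg-cancel : ∀ {x w c} → 0ℚ ℚ.< c → NonNeg (w - embed c) → NonNeg (x * w) → NonNeg x
  nonNeg-cancel {x} {w} {c} 0<c w≥c xw≥0 = nonNeg-stable λ g 0<g -x≥g →
    ¬nonNeg-neg-embed {g ℚ.* c} (ℚ.positive⁻¹ _ {{ℚ.pos*pos⇒pos g {{ℚ.positive 0<g}} c {{ℚ.positive 0<c}}}})
      (nonNeg-resp
        (trans
          (solve 4 (λ x w c g →
              (:- x :- g) :* ((w :- c) :+ c) :+ x :* w :+ g :* (w :- c) := :- (g :* c))
            refl x w (embed c) (embed g))
          (-‿cong (sym (*-homo g c))))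
        (nonNeg-+ (nonNeg-+ (nonNeg-* -x≥g (nonNeg-+ w≥c (nonNeg-embed (ℚ.<⇒≤ 0<c)))) xw≥0)
                  (nonNeg-* (nonNeg-embed (ℚ.<⇒≤ 0<g)) w≥c)))

  nonNeg-cancel-embed : ∀ {x c} → 0ℚ ℚ.< c → NonNeg (x * embed c) → NonNeg x
  nonNeg-cancel-embed {x} {c} 0<c = nonNeg-cancel 0<c
    (nonNeg-resp (trans 0#-homo (sym (-‿inverseʳ (embed c)))) (nonNeg-embed ℚ.≤-refl))

  private
    -- If x ≤ -g with g > 0, then x² ≥ g² > 0. Applied to x and to -x, this replaces the usual
    -- argument that a real with square 0 is 0.
    sq-nonPos⇒nonNeg : ∀ {x} → NonNeg (- (x * x)) → NonNeg x
    sq-nonPos⇒nonNeg {x} -xx≥0 = nonNeg-stable λ g 0<g -x≥g →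
      ¬nonNeg-neg-embed {g ℚ.* g} (ℚ.positive⁻¹ _ {{ℚ.pos*pos⇒pos g {{ℚ.positive 0<g}} g {{ℚ.positive 0<g}}}})
        (nonNeg-resp
          (trans
            (solve 2 (λ x g →
                :- (x :* x) :+ ((:- x :- g) :* (:- x :- g) :+ (con 2ℚ :* g) :* (:- x :- g)) := :- (g :* g))
              refl x (embed g))
            (-‿cong (sym (*-homo g g))))
          (nonNeg-+ -xx≥0 (nonNeg-+ (nonNeg-sq _)
            (nonNeg-* (nonNeg-* (nonNeg-const 2ℚ) (nonNeg-embed (ℚ.<⇒≤ 0<g))) -x≥g))))

  sq-nonPos⇒≈0 : ∀ {x} → NonNeg (- (x * x)) → x ≈ 0#
  sq-nonPos⇒≈0 {x} -xx≥0 = nonNeg-antisym (sq-nonPos⇒nonNeg -xx≥0)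
    (sq-nonPos⇒nonNeg (nonNeg-resp (solve 1 (λ x → :- (x :* x) := :- (:- x :* :- x)) refl x) -xx≥0))

  -- Since w is not known to be apart from 0, it cannot be inverted. But if x ≥ g > 0, then 0 ≤ w (x
  -- - g) = -w g forces w ≤ 0, hence w ≈ 0, a contradiction.
  nonPos-of-product : ∀ {w x} → NonNeg w → ¬ (w ≈ 0#) → w * x ≈ 0# → NonNeg (- x)
  nonPos-of-product {w} {x} w≥0 w≉0 wx≈0 = nonNeg-stable λ g 0<g x≥g →
    w≉0 (nonNeg-antisym w≥0 (nonNeg-cancel-embed 0<g (nonNeg-resp
      (begin
        w * (- - x - embed g)     ≈⟨ solve 3 (λ w x g → w :* (:- :- x :- g) := w :* x :+ :- w :* g) refl w x (embed g) ⟩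
        w * x + - w * embed g     ≈⟨ +-congʳ wx≈0 ⟩
        0# + - w * embed g        ≈⟨ +-identityˡ _ ⟩
        - w * embed g             ∎)
      (nonNeg-* w≥0 x≥g))))

  -- Bernoulli's inequality gives xₙ ≥ (1 + n g) x₀.
  bounded-expanding⇒nonPos : (x : ℕ → Carrier) (b : Carrier) (g : ℚ) → 0ℚ ℚ.< g →
    NonNeg (b - embed 1ℚ - embed g) →
    (∀ n → NonNeg (x n)) → (∀ n → x (suc n) ≈ b * x n) → (∀ n → NonNeg (embed 1ℚ - x n)) →
    NonNeg (- x 0)
  bounded-expanding⇒nonPos x b g 0<g b≥1+g x≥0 x-step x≤1 = nonNeg-stable contra
    where
    g≥0 : NonNeg (embed g)
    g≥0 = nonNeg-embed (ℚ.<⇒≤ 0<g)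
    ιn≥0 : ∀ n → NonNeg (embed (ι n))
    ιn≥0 n = nonNeg-embed (ι-≤ {0} {n} ℕ.z≤n)
    bernoulli : ∀ n → NonNeg (x n - (embed 1ℚ + embed (ι n) * embed g) * x 0)
    bernoulli zero = nonNeg-resp
      (solve 2 (λ x₀ g → con 0ℚ := x₀ :- (con 1ℚ :+ con (ι 0) :* g) :* x₀) refl (x 0) (embed g))
      (nonNeg-const 0ℚ)
    bernoulli (suc n) = nonNeg-resp
      (begin
        (b - embed 1ℚ - embed g) * x n
          + (embed 1ℚ + embed g) * (x n - (embed 1ℚ + embed (ι n) * embed g) * x 0)
          + embed (ι n) * (embed g * embed g) * x 0
          ≈⟨ solve 5 (λ b x₀ xₙ g n →
               (b :- con 1ℚ :- g) :* xₙ :+ (con 1ℚ :+ g) :* (xₙ :- (con 1ℚ :+ n :* g) :* x₀)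
                 :+ n :* (g :* g) :* x₀
               := b :* xₙ :- (con 1ℚ :+ (n :+ con 1ℚ) :* g) :* x₀)
               refl b (x 0) (x n) (embed g) (embed (ι n)) ⟩
        b * x n - (embed 1ℚ + (embed (ι n) + embed 1ℚ) * embed g) * x 0
          ≈⟨ +-cong (sym (x-step n)) (-‿cong (*-congʳ (+-congˡ (*-congʳ
               (trans (sym (+-homo (ι n) 1ℚ)) (reflexive (≡.cong embed (≡.sym (ι-suc n))))))))) ⟩
        x (suc n) - (embed 1ℚ + embed (ι (suc n)) * embed g) * x 0 ∎)
      (nonNeg-+ (nonNeg-+ (nonNeg-* b≥1+g (x≥0 n))
        (nonNeg-* (nonNeg-+ (nonNeg-const 1ℚ) g≥0) (bernoulli n)))
        (nonNeg-* (nonNeg-* (ιn≥0 n) (nonNeg-* g≥0 g≥0)) (x≥0 0)))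
    contra : ∀ h → 0ℚ ℚ.< h → ¬ NonNeg (- - x 0 - embed h)
    -- At n = k + 1 the archimedean bound gives n g h ≥ 1, so x₀ ≥ h would make xₙ ≥ (1 + n g) h ≥ h
    -- + 1, above the bound 1.
    contra h 0<h x₀≥h with archimedean {g ℚ.* h}
      (ℚ.positive⁻¹ _ {{ℚ.pos*pos⇒pos g {{ℚ.positive 0<g}} h {{ℚ.positive 0<h}}}})
    ... | k , 1≤gh = ¬nonNeg-neg-embed 0<h (nonNeg-resp
      (solve 5 (λ x₀ xₙ g h n →
          (con 1ℚ :- xₙ) :+ (xₙ :- (con 1ℚ :+ n :* g) :* x₀)
            :+ ((con 1ℚ :+ n :* g) :* (:- :- x₀ :- h) :+ (g :* h :* n :- con 1ℚ)) := :- h)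
        refl (x 0) (x (suc k)) (embed g) (embed h) (embed (ι (suc k))))
      (nonNeg-+ (nonNeg-+ (x≤1 (suc k)) (bernoulli (suc k))) (nonNeg-+
        (nonNeg-* (nonNeg-+ (nonNeg-const 1ℚ) (nonNeg-* (ιn≥0 (suc k)) g≥0)) x₀≥h)
        (nonNeg-resp ghn-1 (nonNeg-embed (p≤q⇒0≤q-p (1≤gh k ℕ.≤-refl)))))))
      where
      ghn-1 : embed (g ℚ.* h ℚ.* ι (suc k) ℚ.- 1ℚ) ≈ embed g * embed h * embed (ι (suc k)) - embed 1ℚ
      ghn-1 = trans (+-homo _ _) (+-cong (trans (*-homo _ _) (*-congʳ (*-homo g h))) (-‿homo 1ℚ))

  -- Here y = a + c i and U = e + f i.  The increase comes from the bound
  -- ∣y U + u∣² ≥ ½ ∣y U∣² - 1.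
  norm-growth : ∀ a c e f u →
    NonNeg (a * a + c * c - embed 7/2) → NonNeg u → NonNeg (embed 1ℚ - u) →
    NonNeg (e * e + f * f - embed 36/25) →
    NonNeg ((a * e - c * f + u) * (a * e - c * f + u) + (a * f + c * e) * (a * f + c * e)
      - (e * e + f * f) - embed 2/25)
  norm-growth a c e f u y≥ u≥0 u≤1 U≥ = nonNeg-resp
    (solve 5 (λ a c e f u →
        let A = a :* e :- c :* f
            B = a :* f :+ c :* e
            N = e :* e :+ f :* f
        in con ½ :* (((A :+ con 2ℚ :* u) :* (A :+ con 2ℚ :* u)) :+ B :* B)
          :+ (con 1ℚ :- u) :* (con 1ℚ :+ u)
          :+ con ½ :* ((a :* a :+ c :* c :- con 7/2) :* N)
          -- Here ¾ = ½ · 7/2 - 1 is what remains of ½ ∣y∣² N after subtracting N, and ¾ · 36/25 - 1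
          -- = 2/25 is the guaranteed increase.
          :+ con ¾ :* (N :- con 36/25)
        := (A :+ u) :* (A :+ u) :+ B :* B :- N :- con 2/25)
      refl a c e f u)
    (nonNeg-+ (nonNeg-+ (nonNeg-+
      (nonNeg-* (nonNeg-const ½) (nonNeg-+ (nonNeg-sq _) (nonNeg-sq _)))
      (nonNeg-* u≤1 (nonNeg-+ (nonNeg-const 1ℚ) u≥0)))
      (nonNeg-* (nonNeg-const ½) (nonNeg-* y≥ (nonNeg-+ (nonNeg-sq e) (nonNeg-sq f)))))
      (nonNeg-* (nonNeg-const ¾) U≥))

  -- With y = a + c i this says ∣y² + u₁ y + u₂∣ ≥ 6/5.  It holds because the real part R of the product with the
  -- conjugate of y² is at least (6/5) ∣y∣²: R is affine in u₂, so this only needs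
  -- to be checked at u₂ = 0 and u₂ = 1.
  norm-start : ∀ a c u₁ u₂ →
    NonNeg (a * a + c * c - embed 7/2) →
    NonNeg u₁ → NonNeg (embed 1ℚ - u₁) → NonNeg u₂ → NonNeg (embed 1ℚ - u₂) →
    let e = a * a - c * c + u₁ * a + u₂
        f = a * c + c * a + u₁ * c
    in NonNeg (e * e + f * f - embed 36/25)
  norm-start a c u₁ u₂ y≥ u₁≥0 u₁≤1 u₂≥0 u₂≤1 =
    -- With R and I the real and imaginary parts of the product with the conjugate of y², R² + I² is
    -- the squared norm of y² + u₁ y + u₂ times s². So R ≥ (6/5) s gives the claim multiplied by s²,
    -- and s ≥ 7/2 is cancelled twice.
    nonNeg-cancel 0<7/2 y≥ (nonNeg-cancel 0<7/2 y≥ (nonNeg-resp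
      (solve 4 (λ a c u₁ u₂ →
          let s = a :* a :+ c :* c
              e = a :* a :- c :* c :+ u₁ :* a :+ u₂
              f = a :* c :+ c :* a :+ u₁ :* c
              R = s :* s :+ u₁ :* a :* s :+ u₂ :* (con 2ℚ :* (a :* a) :- s)
              I = (a :* a :- c :* c) :* f :- con 2ℚ :* a :* c :* e
              D = R :- con 6/5 :* s
          in I :* I :+ D :* D :+ con 2ℚ :* (con 6/5 :* s) :* D
             := (e :* e :+ f :* f :- con 36/25) :* s :* s)
        refl a c u₁ u₂)
      (nonNeg-+ (nonNeg-+ (nonNeg-sq _) (nonNeg-sq _))
        (nonNeg-* (nonNeg-* (nonNeg-const 2ℚ) (nonNeg-* (nonNeg-const 6/5) s≥0)) R≥))))
    where
    s : Carrier
    s = a * a + c * c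
    0<7/2 : 0ℚ ℚ.< 7/2
    0<7/2 = ℚ.positive⁻¹ 7/2
    s≥0 : NonNeg s
    s≥0 = nonNeg-+ (nonNeg-sq a) (nonNeg-sq c)
    1-u₁²≥0 : NonNeg ((embed 1ℚ - u₁) * (embed 1ℚ + u₁))
    1-u₁²≥0 = nonNeg-* u₁≤1 (nonNeg-+ (nonNeg-const 1ℚ) u₁≥0)
    R≥ : NonNeg (s * s + u₁ * a * s + u₂ * (embed 2ℚ * (a * a) - s) - embed 6/5 * s)
    R≥ = nonNeg-resp
      (solve 4 (λ a c u₁ u₂ →
          let s = a :* a :+ c :* c
          -- The interpolation 1 - u₂, u₂ between the endpoints. At u₂ = 0 the square is completed
          -- in u₁, at u₂ = 1 in a; both remainders use u₁² ≤ 1 and s ≥ 7/2, and 17/40 and 69/80 are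
          -- the slack left over.
          in (con 1ℚ :- u₂) :* (s :* ((con ½ :* a :+ u₁) :* (con ½ :* a :+ u₁)
               :+ (con 1ℚ :- u₁) :* (con 1ℚ :+ u₁)
               :+ con ¼ :* (c :* c) :+ con ¾ :* (s :- con 7/2) :+ con 17/40))
             :+ u₂ :* (con 2ℚ :* ((a :+ con ¼ :* u₁ :* s) :* (a :+ con ¼ :* u₁ :* s))
               :+ con ⅛ :* (s :* s) :* ((con 1ℚ :- u₁) :* (con 1ℚ :+ u₁))
               :+ s :* (con ⅞ :* (s :- con 7/2) :+ con 69/80))
             := s :* s :+ u₁ :* a :* s :+ u₂ :* (con 2ℚ :* (a :* a) :- s) :- con 6/5 :* s)
        refl a c u₁ u₂)
      (nonNeg-+
        (nonNeg-* u₂≤1 (nonNeg-* s≥0 (nonNeg-+ (nonNeg-+ (nonNeg-+ (nonNeg-+ (nonNeg-sq _) 1-u₁²≥0)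
          (nonNeg-* (nonNeg-const ¼) (nonNeg-sq c))) (nonNeg-* (nonNeg-const ¾) y≥)) (nonNeg-const 17/40))))
        (nonNeg-* u₂≥0 (nonNeg-+ (nonNeg-+ (nonNeg-* (nonNeg-const 2ℚ) (nonNeg-sq _))
          (nonNeg-* (nonNeg-* (nonNeg-const ⅛) (nonNeg-sq s)) 1-u₁²≥0))
          (nonNeg-* s≥0 (nonNeg-+ (nonNeg-* (nonNeg-const ⅞) y≥) (nonNeg-const 69/80))))))

-- Growth of the norm against periodicity

module NormGrowth (A : OrderedℚAlgebra) where

  open OrderedℚAlgebra A
  open OrderedℚAlgebraProperties A
  open Solver using (solve; _:+_; _:*_; _:-_; :-_; _:=_; con)
  open Relation.Binary.Reasoning.Setoid setoid

  -- The components e n + (f n) i of the sequence U₀ = 0, Uₙ₊₁ = y Uₙ + uₙ,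
  -- where y = a + c i.
  not-eventually-periodic : ∀ a c (u e f : ℕ → Carrier) →
    NonNeg (a * a + c * c - embed 7/2) →
    (∀ n → NonNeg (u n)) → (∀ n → NonNeg (embed 1ℚ - u n)) → u 0 ≈ embed 1ℚ →
    e 0 ≈ 0# → f 0 ≈ 0# →
    (∀ n → e (suc n) ≈ a * e n - c * f n + u n) →
    (∀ n → f (suc n) ≈ a * f n + c * e n) →
    ∀ m p → 1 ℕ.≤ p →
    (∀ n → m ℕ.≤ n → e (n ℕ.+ p) ≈ e n) → ¬ (∀ n → m ℕ.≤ n → f (n ℕ.+ p) ≈ f n)
  not-eventually-periodic a c u e f y≥ u≥0 u≤1 u₀≈1 e₀≈0 f₀≈0 e-step f-step m (suc p) _ e-per f-per =
    embed-neg (nonNeg-resp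
      (begin
        ∣U∣² (m+3 ℕ.+ suc p) - ∣U∣² m+3 - embed 2/25
          ≈⟨ +-congʳ (+-congʳ (∣U∣²-cong (e-per m+3 m≤m+3) (f-per m+3 m≤m+3))) ⟩
        ∣U∣² m+3 - ∣U∣² m+3 - embed 2/25
          ≈⟨ solve 1 (λ x → x :- x :- con 2/25 := :- con 2/25) refl (∣U∣² m+3) ⟩
        - embed 2/25 ∎)
      (≡.subst (λ k → NonNeg (∣U∣² k - ∣U∣² m+3 - embed 2/25)) (≡.sym (ℕ.+-suc m+3 p))
        (increase p)))
    where
    embed-neg : ¬ NonNeg (- embed 2/25)
    embed-neg = ¬nonNeg-neg-embed (ℚ.positive⁻¹ 2/25)
    m+3 : ℕ
    -- An index that is at least m, where periodicity holds, and at least 3, where growth holds.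
    m+3 = 3 ℕ.+ m
    m≤m+3 : m ℕ.≤ m+3
    m≤m+3 = ℕ.m≤n+m m 3
    ∣U∣² : ℕ → Carrier
    ∣U∣² n = e n * e n + f n * f n
    ∣U∣²-cong : ∀ {x x′ y y′} → x ≈ x′ → y ≈ y′ → x * x + y * y ≈ x′ * x′ + y′ * y′
    ∣U∣²-cong x≈ y≈ = +-cong (*-cong x≈ x≈) (*-cong y≈ y≈)
    e₁≈1 : e 1 ≈ embed 1ℚ
    e₁≈1 = begin
      e 1                      ≈⟨ e-step 0 ⟩
      a * e 0 - c * f 0 + u 0  ≈⟨ +-cong (+-cong (*-congˡ (trans e₀≈0 (sym 0#-homo)))
                                     (-‿cong (*-congˡ (trans f₀≈0 (sym 0#-homo))))) u₀≈1 ⟩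
      a * embed 0ℚ - c * embed 0ℚ + embed 1ℚ
                               ≈⟨ solve 2 (λ a c → a :* con 0ℚ :- c :* con 0ℚ :+ con 1ℚ := con 1ℚ) refl a c ⟩
      embed 1ℚ                 ∎
    f₁≈0 : f 1 ≈ embed 0ℚ
    f₁≈0 = begin
      f 1                  ≈⟨ f-step 0 ⟩
      a * f 0 + c * e 0    ≈⟨ +-cong (*-congˡ (trans f₀≈0 (sym 0#-homo))) (*-congˡ (trans e₀≈0 (sym 0#-homo))) ⟩
      a * embed 0ℚ + c * embed 0ℚ
                           ≈⟨ solve 2 (λ a c → a :* con 0ℚ :+ c :* con 0ℚ := con 0ℚ) refl a c ⟩
      embed 0ℚ             ∎
    e₂≈ : e 2 ≈ a + u 1
    e₂≈ = begin
      e 2                      ≈⟨ e-step 1 ⟩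
      a * e 1 - c * f 1 + u 1  ≈⟨ +-congʳ (+-cong (*-congˡ e₁≈1) (-‿cong (*-congˡ f₁≈0))) ⟩
      a * embed 1ℚ - c * embed 0ℚ + u 1
                               ≈⟨ solve 3 (λ a c u → a :* con 1ℚ :- c :* con 0ℚ :+ u := a :+ u) refl a c (u 1) ⟩
      a + u 1                  ∎
    f₂≈ : f 2 ≈ c
    f₂≈ = begin
      f 2                  ≈⟨ f-step 1 ⟩
      a * f 1 + c * e 1    ≈⟨ +-cong (*-congˡ f₁≈0) (*-congˡ e₁≈1) ⟩
      a * embed 0ℚ + c * embed 1ℚ
                           ≈⟨ solve 2 (λ a c → a :* con 0ℚ :+ c :* con 1ℚ := c) refl a c ⟩
      c                    ∎
    e₃≈ : a * a - c * c + u 1 * a + u 2 ≈ e 3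
    e₃≈ = begin
      a * a - c * c + u 1 * a + u 2  ≈⟨ solve 4 (λ a c u v →
                                          a :* a :- c :* c :+ u :* a :+ v := a :* (a :+ u) :- c :* c :+ v)
                                          refl a c (u 1) (u 2) ⟩
      a * (a + u 1) - c * c + u 2    ≈⟨ +-congʳ (+-cong (*-congˡ e₂≈) (-‿cong (*-congˡ f₂≈))) ⟨
      a * e 2 - c * f 2 + u 2        ≈⟨ e-step 2 ⟨
      e 3                            ∎
    f₃≈ : a * c + c * a + u 1 * c ≈ f 3
    f₃≈ = begin
      a * c + c * a + u 1 * c  ≈⟨ solve 3 (λ a c u → a :* c :+ c :* a :+ u :* c := a :* c :+ c :* (a :+ u))
                                    refl a c (u 1) ⟩
      a * c + c * (a + u 1)    ≈⟨ +-cong (*-congˡ f₂≈) (*-congˡ e₂≈) ⟨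
      a * f 2 + c * e 2        ≈⟨ f-step 2 ⟨
      f 3                      ∎
    grow : ∀ n → NonNeg (∣U∣² n - embed 36/25) → NonNeg (∣U∣² (suc n) - ∣U∣² n - embed 2/25)
    grow n U≥ = nonNeg-resp
      (+-congʳ (+-congʳ (sym (∣U∣²-cong (e-step n) (f-step n)))))
      (norm-growth a c (e n) (f n) (u n) y≥ (u≥0 n) (u≤1 n) U≥)
    lower : ∀ n → NonNeg (∣U∣² (3 ℕ.+ n) - embed 36/25)
    lower zero = nonNeg-resp (+-congʳ (∣U∣²-cong e₃≈ f₃≈))
      (norm-start a c (u 1) (u 2) y≥ (u≥0 1) (u≤1 1) (u≥0 2) (u≤1 2))
    lower (suc n) = nonNeg-resp
      (solve 2 (λ x y → x :- y :- con 2/25 :+ (y :- con 36/25) :+ con 2/25 := x :- con 36/25)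
        refl (∣U∣² (4 ℕ.+ n)) (∣U∣² (3 ℕ.+ n)))
      (nonNeg-+ (nonNeg-+ (grow (3 ℕ.+ n) (lower n)) (lower n)) (nonNeg-const 2/25))
    -- The norm at any later index exceeds the norm at `m+3` by at least one increment. One is
    -- enough for the contradiction, so the further increments are dropped; the outer `suc` matches
    -- the period `suc p`.
    increase : ∀ k → NonNeg (∣U∣² (suc (m+3 ℕ.+ k)) - ∣U∣² m+3 - embed 2/25)
    increase zero = ≡.subst (λ k → NonNeg (∣U∣² (suc k) - ∣U∣² m+3 - embed 2/25)) (≡.sym (ℕ.+-identityʳ m+3))
      (grow m+3 (lower m))
    increase (suc k) = ≡.subst (λ j → NonNeg (∣U∣² (suc j) - ∣U∣² m+3 - embed 2/25)) (≡.sym (ℕ.+-suc m+3 k))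
      (nonNeg-resp
        (solve 3 (λ x y z → x :- y :- con 2/25 :+ (y :- z :- con 2/25) :+ con 2/25 := x :- z :- con 2/25)
          refl (∣U∣² (2 ℕ.+ (m+3 ℕ.+ k))) (∣U∣² (suc (m+3 ℕ.+ k))) (∣U∣² m+3))
        (nonNeg-+ (nonNeg-+ (grow (suc (m+3 ℕ.+ k)) (lower (suc (m ℕ.+ k)))) (increase k)) (nonNeg-const 2/25)))

-- Horner sums and the factorisation of the Ito-Sadahiro polynomial

module HornerSums (A : ℚ-Algebra) where

  open ℚ-Algebra A
  open Solver using (solve; _:+_; _:*_; _:-_; :-_; _:=_; con)
  open Relation.Binary.Reasoning.Setoid setoid
  open Algebra.Definitions.RawSemiring (RawRing.rawSemiring rawRing) using (_^_; sum)
  open Algebra.Properties.Semiring.Sum semiring using (*-distribˡ-sum; sum-cong-≋)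

  -- The recursion of U with an arbitrary input sequence, so that U, the digit sums and the
  -- geometric sums of the polynomial are all instances. The coefficient `a 0` is the leading one.
  horner : Carrier → (ℕ → Carrier) → ℕ → Carrier
  horner y a zero    = 0#
  horner y a (suc n) = y * horner y a n + a n

  horner-head : ∀ y a n → horner y a (suc n) ≈ a 0 * y ^ n + horner y (λ i → a (suc i)) n
  horner-head y a zero = begin
    y * 0# + a 0      ≈⟨ +-cong (zeroʳ y) (sym (*-identityʳ (a 0))) ⟩
    0# + a 0 * 1#     ≈⟨ +-comm _ _ ⟩
    a 0 * 1# + 0#     ∎
  horner-head y a (suc n) = begin
    y * horner y a (suc n) + a (suc n)
      ≈⟨ +-congʳ (*-congˡ (horner-head y a n)) ⟩
    y * (a 0 * y ^ n + horner y (λ i → a (suc i)) n) + a (suc n)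
      ≈⟨ solve 5 (λ y b z h c → y :* (b :* z :+ h) :+ c := b :* (y :* z) :+ (y :* h :+ c))
           refl y (a 0) (y ^ n) (horner y (λ i → a (suc i)) n) (a (suc n)) ⟩
    a 0 * (y * y ^ n) + (y * horner y (λ i → a (suc i)) n + a (suc n)) ∎

  sum≈horner : ∀ y a n → sum {n} (λ i → a (toℕ i) * y ^ (n ∸ suc (toℕ i))) ≈ horner y a n
  sum≈horner y a zero    = refl
  sum≈horner y a (suc n) = trans (+-congˡ (sum≈horner y (λ i → a (suc i)) n)) (sym (horner-head y a n))

  -- Splitting the coefficients into two blocks. It merges the preperiod and the period of the
  -- expansion into one prefix of length m + p.
  horner-+ : ∀ y a m n → horner y a (m ℕ.+ n) ≈ y ^ n * horner y a m + horner y (λ i → a (m ℕ.+ i)) n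
  horner-+ y a m zero = begin
    horner y a (m ℕ.+ 0)       ≡⟨ ≡.cong (horner y a) (ℕ.+-identityʳ m) ⟩
    horner y a m               ≈⟨ *-identityˡ _ ⟨
    1# * horner y a m          ≈⟨ +-identityʳ _ ⟨
    1# * horner y a m + 0#     ∎
  horner-+ y a m (suc n) = begin
    horner y a (m ℕ.+ suc n)
      ≡⟨ ≡.cong (horner y a) (ℕ.+-suc m n) ⟩
    y * horner y a (m ℕ.+ n) + a (m ℕ.+ n)
      ≈⟨ +-congʳ (*-congˡ (horner-+ y a m n)) ⟩
    y * (y ^ n * horner y a m + horner y (λ i → a (m ℕ.+ i)) n) + a (m ℕ.+ n)
      ≈⟨ solve 5 (λ y z h k c → y :* (z :* h :+ k) :+ c := y :* z :* h :+ (y :* k :+ c))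
           refl y (y ^ n) (horner y a m) (horner y (λ i → a (m ℕ.+ i)) n) (a (m ℕ.+ n)) ⟩
    y ^ suc n * horner y a m + horner y (λ i → a (m ℕ.+ i)) (suc n) ∎

  -- The coefficient is `embed 1ℚ` and not `1#`, so that the solver sees it as the constant
  -- `con 1ℚ`.
  geometric : Carrier → ℕ → Carrier
  geometric y = horner y (λ _ → embed 1ℚ)

  sum≈geometric : ∀ y n → sum {n} (λ i → y ^ toℕ i) ≈ geometric y n
  sum≈geometric y zero    = refl
  sum≈geometric y (suc n) = begin
    1# + sum {n} (λ i → y * y ^ toℕ i)  ≈⟨ +-cong 1#-homo (*-distribˡ-sum {n} y (λ i → y ^ toℕ i)) ⟨
    embed 1ℚ + y * sum {n} (λ i → y ^ toℕ i)
                                        ≈⟨ +-comm _ _ ⟩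
    y * sum {n} (λ i → y ^ toℕ i) + embed 1ℚ
                                        ≈⟨ +-congʳ (*-congˡ (sum≈geometric y n)) ⟩
    y * geometric y n + embed 1ℚ        ∎

  geometric-closed : ∀ y n → (y - embed 1ℚ) * geometric y n ≈ y ^ n - embed 1ℚ
  geometric-closed y zero = begin
    (y - embed 1ℚ) * 0#   ≈⟨ zeroʳ _ ⟩
    0#                    ≈⟨ -‿inverseʳ (embed 1ℚ) ⟨
    embed 1ℚ - embed 1ℚ   ≈⟨ +-congʳ 1#-homo ⟩
    1# - embed 1ℚ         ∎
  geometric-closed y (suc n) = begin
    (y - embed 1ℚ) * (y * geometric y n + embed 1ℚ)
      ≈⟨ solve 2 (λ y g → (y :- con 1ℚ) :* (y :* g :+ con 1ℚ) := y :* ((y :- con 1ℚ) :* g) :+ (y :- con 1ℚ))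
           refl y (geometric y n) ⟩
    y * ((y - embed 1ℚ) * geometric y n) + (y - embed 1ℚ)
      ≈⟨ +-congʳ (*-congˡ (geometric-closed y n)) ⟩
    y * (y ^ n - embed 1ℚ) + (y - embed 1ℚ)
      ≈⟨ solve 2 (λ y z → y :* (z :- con 1ℚ) :+ (y :- con 1ℚ) := y :* z :- con 1ℚ) refl y (y ^ n) ⟩
    y ^ suc n - embed 1ℚ ∎

  -- `itoSadahiroPolynomial` in the variable y = -x over any algebra; over ℂ the two agree
  -- definitionally.
  polynomial : Carrier → (ℕ → Carrier) → ℕ → ℕ → Carrier
  polynomial y d m p =
      y ^ suc m * sum {p} (λ i → y ^ toℕ i)
    + (y ^ p - 1#) * sum {m} (λ i → d (toℕ i) * y ^ (m ∸ suc (toℕ i)))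
    + sum {p} (λ i → d (m ℕ.+ toℕ i) * y ^ (p ∸ suc (toℕ i)))

  polynomial≈ : ∀ y d m p → polynomial y d m p ≈
    y * (geometric y (m ℕ.+ p) - geometric y m) + (horner y d (m ℕ.+ p) - horner y d m)
  polynomial≈ y d m p = begin
    polynomial y d m p
      ≈⟨ +-cong (+-cong (*-congˡ (sum≈geometric y p))
           (*-cong (+-congˡ (-‿cong (sym 1#-homo))) (sum≈horner y d m)))
           (sum≈horner y (λ i → d (m ℕ.+ i)) p) ⟩
    y * y ^ m * g p + (y ^ p - embed 1ℚ) * h m + k
      ≈⟨ solve 6 (λ y ym yp gp hm k →
           y :* ym :* gp :+ (yp :- con 1ℚ) :* hm :+ k
           := y :* ((ym :- con 1ℚ) :* gp :+ gp) :+ (yp :* hm :+ k :- hm))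
           refl y (y ^ m) (y ^ p) (g p) (h m) k ⟩
    y * ((y ^ m - embed 1ℚ) * g p + g p) + (y ^ p * h m + k - h m)
      -- The polynomial contains y^m times the geometric sum of length p, while `horner-+` produces
      -- y^p times the sum of length m. Passing through the symmetric product (y - 1) `g m` `g p`
      -- exchanges the two.
      ≈⟨ +-congʳ (*-congˡ (+-congʳ (*-congʳ (geometric-closed y m)))) ⟨
    y * ((y - embed 1ℚ) * g m * g p + g p) + (y ^ p * h m + k - h m)
      ≈⟨ solve 6 (λ y gm gp yp hm k →
           y :* ((y :- con 1ℚ) :* gm :* gp :+ gp) :+ (yp :* hm :+ k :- hm)
           := y :* (((y :- con 1ℚ) :* gp :+ con 1ℚ) :* gm :+ gp :- gm) :+ (yp :* hm :+ k :- hm))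
           refl y (g m) (g p) (y ^ p) (h m) k ⟩
    y * (((y - embed 1ℚ) * g p + embed 1ℚ) * g m + g p - g m) + (y ^ p * h m + k - h m)
      ≈⟨ +-congʳ (*-congˡ (+-congʳ (+-congʳ (*-congʳ (trans (+-congʳ (geometric-closed y p))
           (solve 1 (λ z → z :- con 1ℚ :+ con 1ℚ := z) refl (y ^ p))))))) ⟩
    y * (y ^ p * g m + g p - g m) + (y ^ p * h m + k - h m)
      ≈⟨ +-cong (*-congˡ (+-congʳ (horner-+ y _ m p))) (+-congʳ (horner-+ y d m p)) ⟨
    y * (g (m ℕ.+ p) - g m) + (h (m ℕ.+ p) - h m) ∎
    where
    g h : ℕ → Carrier
    g = geometric y
    h = horner y d
    k : Carrier
    k = horner y (λ i → d (m ℕ.+ i)) p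

  module _ {b l r : Carrier} {t d : ℕ → Carrier} (l≈br : l ≈ b * r) (r≈l+1 : r ≈ l + embed 1ℚ)
    (t₀≈l : t 0 ≈ l) (t-step : ∀ n → t (suc n) ≈ b * t n - d n) (y : Carrier) where

    remainders : ℕ → Carrier
    remainders = horner y (λ i → r - t i)

    -- Seen as a polynomial in y, the right side vanishes at y = b: there t n = bⁿ l minus the
    -- Horner sum of the digits, and b + (b - 1) l = 0 by l = b r and r = l + 1. `remainders n` is
    -- the quotient by y - b. With b = -β it is Uₙ.
    remainders≈ : ∀ n → (y - b) * remainders n ≈ horner y d n + t n - l + y * geometric y n
    remainders≈ zero = begin
      (y - b) * 0#        ≈⟨ zeroʳ _ ⟩
      0#                  ≈⟨ -‿inverseʳ l ⟨
      l - l               ≈⟨ +-congʳ t₀≈l ⟨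
      t 0 - l             ≈⟨ +-congʳ (+-identityˡ (t 0)) ⟨
      0# + t 0 - l        ≈⟨ +-identityʳ _ ⟨
      0# + t 0 - l + 0#   ≈⟨ +-congˡ (zeroʳ y) ⟨
      0# + t 0 - l + y * 0#  ∎
    remainders≈ (suc n) = begin
      (y - b) * (y * u + (r - t n))
        ≈⟨ solve 5 (λ y b u r t →
             (y :- b) :* (y :* u :+ (r :- t)) := y :* ((y :- b) :* u) :+ (y :* r :- b :* r :- (y :- b) :* t))
             refl y b u r (t n) ⟩
      y * ((y - b) * u) + (y * r - b * r - (y - b) * t n)
        ≈⟨ +-cong (*-congˡ (remainders≈ n)) (+-congʳ (+-cong (*-congˡ r≈l+1) (-‿cong (sym l≈br)))) ⟩
      y * (h + t n - l + y * g) + (y * (l + embed 1ℚ) - l - (y - b) * t n)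
        ≈⟨ solve 7 (λ y b h t l g d →
             y :* (h :+ t :- l :+ y :* g) :+ (y :* (l :+ con 1ℚ) :- l :- (y :- b) :* t)
             := (y :* h :+ d) :+ (b :* t :- d) :- l :+ y :* (y :* g :+ con 1ℚ))
             refl y b h (t n) l g (d n) ⟩
      (y * h + d n) + (b * t n - d n) - l + y * (y * g + embed 1ℚ)
        ≈⟨ +-congʳ (+-congʳ (+-congˡ (t-step n))) ⟨
      (y * h + d n) + t (suc n) - l + y * (y * g + embed 1ℚ) ∎
      where
      u h g : Carrier
      u = remainders n
      h = horner y d n
      g = geometric y n

    -- Both sides are differences of the formula of `remainders≈` between m + p and m. There l
    -- cancels, and t cancels because the orbit is periodic.
    polynomial-factor : ∀ m p → t (m ℕ.+ p) ≈ t m →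
      polynomial y d m p ≈ (y - b) * (remainders (m ℕ.+ p) - remainders m)
    polynomial-factor m p t-per = begin
      polynomial y d m p
        ≈⟨ polynomial≈ y d m p ⟩
      y * (g (m ℕ.+ p) - g m) + (h (m ℕ.+ p) - h m)
        ≈⟨ solve 7 (λ y g′ g h′ h t l →
             y :* (g′ :- g) :+ (h′ :- h) := (h′ :+ t :- l :+ y :* g′) :- (h :+ t :- l :+ y :* g))
             refl y (g (m ℕ.+ p)) (g m) (h (m ℕ.+ p)) (h m) (t m) l ⟩
      (h (m ℕ.+ p) + t m - l + y * g (m ℕ.+ p)) - (h m + t m - l + y * g m)
        ≈⟨ +-congʳ (+-congʳ (+-congʳ (+-congˡ t-per))) ⟨
      (h (m ℕ.+ p) + t (m ℕ.+ p) - l + y * g (m ℕ.+ p)) - (h m + t m - l + y * g m)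
        ≈⟨ +-cong (remainders≈ (m ℕ.+ p)) (-‿cong (remainders≈ m)) ⟨
      (y - b) * remainders (m ℕ.+ p) - (y - b) * remainders m
        ≈⟨ solve 3 (λ x u v → x :* u :- x :* v := x :* (u :- v)) refl (y - b) (remainders (m ℕ.+ p)) (remainders m) ⟩
      (y - b) * (remainders (m ℕ.+ p) - remainders m) ∎
      where
      g h : ℕ → Carrier
      g = geometric y
      h = horner y d

    remainders-periodic : ∀ m p → (∀ n → m ℕ.≤ n → t (n ℕ.+ p) ≈ t n) →
      remainders (m ℕ.+ p) ≈ remainders m → ∀ n → m ℕ.≤ n → remainders (n ℕ.+ p) ≈ remainders n
    remainders-periodic m p t-per base n m≤n = go (ℕ.≤⇒≤′ m≤n)
      where
      go : ∀ {n} → m ℕ.≤′ n → remainders (n ℕ.+ p) ≈ remainders n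
      go ℕ.≤′-refl             = base
      go (ℕ.≤′-step {n} m≤′n) = +-cong (*-congˡ (go m≤′n)) (+-congˡ (-‿cong (t-per n (ℕ.≤′⇒≤ m≤′n))))

-- Rational polynomials and the transfer of roots to conjugates

length-∷ʳ : ∀ (q : ℚ) qs → length (qs ∷ʳ q) ≡ suc (length qs)
length-∷ʳ q qs = ≡.trans (List.length-++ qs) (ℕ.+-comm (length qs) 1)

infixl 6 _⊞_
infixl 7 _⊠_

_⊞_ : List ℚ → List ℚ → List ℚ
[]       ⊞ qs       = qs
(p ∷ ps) ⊞ []       = p ∷ ps
(p ∷ ps) ⊞ (q ∷ qs) = p ℚ.+ q ∷ ps ⊞ qs

_⊠_ : List ℚ → List ℚ → List ℚ
[]       ⊠ qs = []
(p ∷ ps) ⊠ qs = map (p ℚ.*_) qs ⊞ (0ℚ ∷ ps ⊠ qs)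

length-⊞ : ∀ {n} ps qs → length ps ℕ.≤ n → length qs ℕ.≤ n → length (ps ⊞ qs) ℕ.≤ n
length-⊞ []       qs       _          qs≤        = qs≤
length-⊞ (p ∷ ps) []       ps≤        _          = ps≤
length-⊞ (p ∷ ps) (q ∷ qs) (ℕ.s≤s ps≤) (ℕ.s≤s qs≤) = ℕ.s≤s (length-⊞ ps qs ps≤ qs≤)

-- Polynomials are lists of coefficients, the constant coefficient first.
module Polynomials (A : ℚ-Algebra) where

  open ℚ-Algebra A
  open HornerSums A using (polynomial)
  open Solver using (solve; _:+_; _:*_; _:-_; :-_; _:=_; con)
  open Relation.Binary.Reasoning.Setoid setoid
  open Algebra.Definitions.RawSemiring (RawRing.rawSemiring rawRing) using (_^_; sum)
  open Algebra.Properties.Semiring.Exp semiring using (^-congʳ; ^-homo-*)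
  open Algebra.Properties.Semiring.Sum semiring using (*-distribˡ-sum; sum-cong-≋)

  eval : List ℚ → Carrier → Carrier
  eval []       z = 0#
  eval (q ∷ qs) z = embed q + z * eval qs z

  eval-⊞ : ∀ ps qs z → eval (ps ⊞ qs) z ≈ eval ps z + eval qs z
  eval-⊞ []       qs       z = sym (+-identityˡ _)
  eval-⊞ (p ∷ ps) []       z = sym (+-identityʳ _)
  eval-⊞ (p ∷ ps) (q ∷ qs) z = begin
    embed (p ℚ.+ q) + z * eval (ps ⊞ qs) z
      ≈⟨ +-cong (+-homo p q) (*-congˡ (eval-⊞ ps qs z)) ⟩
    embed p + embed q + z * (eval ps z + eval qs z)
      ≈⟨ solve 5 (λ p q z s t → p :+ q :+ z :* (s :+ t) := p :+ z :* s :+ (q :+ z :* t))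
           refl (embed p) (embed q) z (eval ps z) (eval qs z) ⟩
    embed p + z * eval ps z + (embed q + z * eval qs z) ∎

  eval-scale : ∀ p qs z → eval (map (p ℚ.*_) qs) z ≈ embed p * eval qs z
  eval-scale p []       z = sym (zeroʳ _)
  eval-scale p (q ∷ qs) z = begin
    embed (p ℚ.* q) + z * eval (map (p ℚ.*_) qs) z
      ≈⟨ +-cong (*-homo p q) (*-congˡ (eval-scale p qs z)) ⟩
    embed p * embed q + z * (embed p * eval qs z)
      ≈⟨ solve 4 (λ p q z s → p :* q :+ z :* (p :* s) := p :* (q :+ z :* s))
           refl (embed p) (embed q) z (eval qs z) ⟩
    embed p * (embed q + z * eval qs z) ∎

  eval-shift : ∀ qs z → eval (0ℚ ∷ qs) z ≈ z * eval qs z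
  eval-shift qs z = trans (+-congʳ 0#-homo) (+-identityˡ _)

  eval-shifts : ∀ k qs z → eval (replicate k 0ℚ ++ qs) z ≈ z ^ k * eval qs z
  eval-shifts zero    qs z = sym (*-identityˡ _)
  eval-shifts (suc k) qs z = trans (eval-shift (replicate k 0ℚ ++ qs) z)
    (trans (*-congˡ (eval-shifts k qs z)) (sym (*-assoc z (z ^ k) (eval qs z))))

  eval-⊠ : ∀ ps qs z → eval (ps ⊠ qs) z ≈ eval ps z * eval qs z
  eval-⊠ []       qs z = sym (zeroˡ _)
  eval-⊠ (p ∷ ps) qs z = begin
    eval (map (p ℚ.*_) qs ⊞ (0ℚ ∷ ps ⊠ qs)) z
      ≈⟨ eval-⊞ (map (p ℚ.*_) qs) (0ℚ ∷ ps ⊠ qs) z ⟩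
    eval (map (p ℚ.*_) qs) z + eval (0ℚ ∷ ps ⊠ qs) z
      ≈⟨ +-cong (eval-scale p qs z) (trans (eval-shift (ps ⊠ qs) z) (*-congˡ (eval-⊠ ps qs z))) ⟩
    embed p * eval qs z + z * (eval ps z * eval qs z)
      ≈⟨ solve 4 (λ p z s t → p :* t :+ z :* (s :* t) := (p :+ z :* s) :* t)
           refl (embed p) z (eval ps z) (eval qs z) ⟩
    (embed p + z * eval ps z) * eval qs z ∎

  eval-∷ʳ : ∀ qs q z → eval (qs ∷ʳ q) z ≈ eval qs z + embed q * z ^ length qs
  eval-∷ʳ [] q z = begin
    embed q + z * 0#     ≈⟨ +-congˡ (zeroʳ z) ⟩
    embed q + 0#         ≈⟨ +-comm _ _ ⟩
    0# + embed q         ≈⟨ +-congˡ (*-identityʳ (embed q)) ⟨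
    0# + embed q * 1#    ∎
  eval-∷ʳ (p ∷ ps) q z = begin
    embed p + z * eval (ps ∷ʳ q) z
      ≈⟨ +-congˡ (*-congˡ (eval-∷ʳ ps q z)) ⟩
    embed p + z * (eval ps z + embed q * z ^ length ps)
      ≈⟨ solve 5 (λ p z s q w → p :+ z :* (s :+ q :* w) := p :+ z :* s :+ q :* (z :* w))
           refl (embed p) z (eval ps z) (embed q) (z ^ length ps) ⟩
    embed p + z * eval ps z + embed q * (z * z ^ length ps) ∎

  sum≈eval : ∀ n (a : Vector ℚ n) z → sum {n} (λ i → embed (a i) * z ^ toℕ i) ≈ eval (tabulate a) z
  sum≈eval zero    a z = refl
  sum≈eval (suc n) a z = +-cong (*-identityʳ _) (begin
    sum {n} (λ i → embed (a (Fin.suc i)) * (z * z ^ toℕ i))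
      ≈⟨ sum-cong-≋ {n} (λ i → solve 3 (λ q z w → q :* (z :* w) := z :* (q :* w))
           refl (embed (a (Fin.suc i))) z (z ^ toℕ i)) ⟩
    sum {n} (λ i → z * (embed (a (Fin.suc i)) * z ^ toℕ i))
      ≈⟨ *-distribˡ-sum {n} z (λ i → embed (a (Fin.suc i)) * z ^ toℕ i) ⟨
    z * sum {n} (λ i → embed (a (Fin.suc i)) * z ^ toℕ i)
      ≈⟨ *-congˡ (sum≈eval n (λ i → a (Fin.suc i)) z) ⟩
    z * eval (tabulate (λ i → a (Fin.suc i))) z ∎)

  -- The Ito-Sadahiro polynomial is given as a function, but division by the minimal polynomial
  -- needs coefficients. The closure properties below recover rational ones.
  IsPolynomial : (Carrier → Carrier) → Set
  IsPolynomial F = ∃[ qs ] ∀ z → F z ≈ eval qs z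

  const-isPolynomial : ∀ q → IsPolynomial (λ _ → embed q)
  const-isPolynomial q = q ∷ [] , λ z → sym (trans (+-congˡ (zeroʳ z)) (+-identityʳ _))

  1-isPolynomial : IsPolynomial (λ _ → 1#)
  1-isPolynomial = let (qs , 1≈) = const-isPolynomial 1ℚ in qs , λ z → trans (sym 1#-homo) (1≈ z)

  0-isPolynomial : IsPolynomial (λ _ → 0#)
  0-isPolynomial = [] , λ _ → refl

  neg-isPolynomial : IsPolynomial (λ z → - z)
  neg-isPolynomial = 0ℚ ∷ ℚ.- 1ℚ ∷ [] , λ z → begin
    - z                                                ≈⟨ solve 1 (λ z → :- z := con 0ℚ :+ z :* (con (ℚ.- 1ℚ) :+ z :* con 0ℚ)) refl z ⟩
    embed 0ℚ + z * (embed (ℚ.- 1ℚ) + z * embed 0ℚ)     ≈⟨ +-congˡ (*-congˡ (+-congˡ (*-congˡ 0#-homo))) ⟩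
    embed 0ℚ + z * (embed (ℚ.- 1ℚ) + z * 0#)           ∎

  +-isPolynomial : ∀ {F G} → IsPolynomial F → IsPolynomial G → IsPolynomial (λ z → F z + G z)
  +-isPolynomial (ps , F≈) (qs , G≈) = ps ⊞ qs , λ z → trans (+-cong (F≈ z) (G≈ z)) (sym (eval-⊞ ps qs z))

  *-isPolynomial : ∀ {F G} → IsPolynomial F → IsPolynomial G → IsPolynomial (λ z → F z * G z)
  *-isPolynomial (ps , F≈) (qs , G≈) = ps ⊠ qs , λ z → trans (*-cong (F≈ z) (G≈ z)) (sym (eval-⊠ ps qs z))

  ^-isPolynomial : ∀ {F} n → IsPolynomial F → IsPolynomial (λ z → F z ^ n)
  ^-isPolynomial zero    F-poly = 1-isPolynomial
  ^-isPolynomial (suc n) F-poly = *-isPolynomial F-poly (^-isPolynomial n F-poly)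

  sum-isPolynomial : ∀ n {F : Fin n → Carrier → Carrier} →
    (∀ i → IsPolynomial (F i)) → IsPolynomial (λ z → sum {n} (λ i → F i z))
  sum-isPolynomial zero    F-poly = 0-isPolynomial
  sum-isPolynomial (suc n) F-poly =
    +-isPolynomial (F-poly Fin.zero) (sum-isPolynomial n (λ i → F-poly (Fin.suc i)))

  polynomial-isPolynomial : ∀ (d : ℕ → ℚ) m p →
    IsPolynomial (λ z → polynomial (- z) (λ i → embed (d i)) m p)
  polynomial-isPolynomial d m p = +-isPolynomial (+-isPolynomial
    (*-isPolynomial (power (suc m)) (sum-isPolynomial p (λ i → power (toℕ i))))
    (*-isPolynomial (+-isPolynomial (power p) minus-1) (digits d m)))
    (digits (λ i → d (m ℕ.+ i)) p)
    where
    power : ∀ n → IsPolynomial (λ z → (- z) ^ n)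
    power n = ^-isPolynomial n neg-isPolynomial
    minus-1 : IsPolynomial (λ _ → - 1#)
    minus-1 = let (qs , -1≈) = const-isPolynomial (ℚ.- 1ℚ) in
      qs , λ z → trans (trans (-‿cong (sym 1#-homo)) (sym (-‿homo 1ℚ))) (-1≈ z)
    digits : ∀ (d : ℕ → ℚ) n →
      IsPolynomial (λ z → sum {n} (λ i → embed (d (toℕ i)) * (- z) ^ (n ∸ suc (toℕ i))))
    digits d n = sum-isPolynomial n λ i →
      *-isPolynomial (const-isPolynomial (d (toℕ i))) (power (n ∸ suc (toℕ i)))

  monic : ∀ n → Vector ℚ n → Carrier → Carrier
  monic n a z = z ^ n + sum {n} (λ i → embed (a i) * z ^ toℕ i)

  -- Minimality speaks only of monic polynomials; this makes it applicable to any polynomial with an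
  -- invertible leading coefficient c.
  monic-normalisation : ∀ qs {c d} → d ℚ.* c ≡ 1ℚ → ∀ z →
    monic (length qs) (λ i → d ℚ.* lookup qs i) z ≈ embed d * eval (qs ∷ʳ c) z
  monic-normalisation qs {c} {d} dc≡1 z = begin
    z ^ n + sum {n} (λ i → embed (d ℚ.* lookup qs i) * z ^ toℕ i)
      ≈⟨ +-congˡ (sum≈eval n (λ i → d ℚ.* lookup qs i) z) ⟩
    z ^ n + eval (tabulate (λ i → d ℚ.* lookup qs i)) z
      ≡⟨ ≡.cong (λ ps → z ^ n + eval ps z)
           (≡.trans (≡.sym (List.map-tabulate (lookup qs) (d ℚ.*_))) (≡.cong (map (d ℚ.*_)) (List.tabulate-lookup qs))) ⟩
    z ^ n + eval (map (d ℚ.*_) qs) z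
      ≈⟨ +-cong (sym (trans (*-congʳ (trans (sym (*-homo d c)) (trans (reflexive (≡.cong embed dc≡1)) 1#-homo)))
           (*-identityˡ _))) (eval-scale d qs z) ⟩
    embed d * embed c * z ^ n + embed d * eval qs z
      ≈⟨ solve 4 (λ d c w s → d :* c :* w :+ d :* s := d :* (s :+ c :* w))
           refl (embed d) (embed c) (z ^ n) (eval qs z) ⟩
    embed d * (eval qs z + embed c * z ^ n)
      ≈⟨ *-congˡ (eval-∷ʳ qs c z) ⟨
    embed d * eval (qs ∷ʳ c) z ∎
    where
    n : ℕ
    n = length qs

  -- One step of long division: from the polynomial `qs ∷ʳ c` the multiple c x^k of the monic
  -- polynomial `a` is subtracted. The leading terms cancel when `length qs` is k + n, so only the
  -- lower coefficients are listed.
  reduce : ∀ n → Vector ℚ n → ℕ → List ℚ → ℚ → List ℚ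
  reduce n a k qs c = qs ⊞ (replicate k 0ℚ ++ map ((ℚ.- c) ℚ.*_) (tabulate a))

  length-reduce : ∀ n (a : Vector ℚ n) k qs c → length qs ≡ k ℕ.+ n → length (reduce n a k qs c) ℕ.≤ k ℕ.+ n
  length-reduce n a k qs c len = length-⊞ qs _ (ℕ.≤-reflexive len) (ℕ.≤-reflexive
    (≡.trans (List.length-++ (replicate k 0ℚ))
      (≡.cong₂ ℕ._+_ (List.length-replicate k)
        (≡.trans (List.length-map ((ℚ.- c) ℚ.*_) (tabulate a)) (List.length-tabulate a)))))

  eval-reduce : ∀ n (a : Vector ℚ n) k qs c z → length qs ≡ k ℕ.+ n →
    eval (qs ∷ʳ c) z ≈ eval (reduce n a k qs c) z + embed c * z ^ k * monic n a z
  eval-reduce n a k qs c z len = begin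
    eval (qs ∷ʳ c) z
      ≈⟨ eval-∷ʳ qs c z ⟩
    eval qs z + embed c * z ^ length qs
      ≈⟨ +-congˡ (*-congˡ (trans (^-congʳ z len) (^-homo-* z k n))) ⟩
    eval qs z + embed c * (z ^ k * z ^ n)
      ≈⟨ solve 5 (λ q c w v s → q :+ c :* (w :* v) := q :+ w :* (:- c :* s) :+ c :* w :* (v :+ s))
           refl (eval qs z) (embed c) (z ^ k) (z ^ n) (eval (tabulate a) z) ⟩
    eval qs z + z ^ k * (- embed c * eval (tabulate a) z) + embed c * z ^ k * (z ^ n + eval (tabulate a) z)
      ≈⟨ +-cong (+-congˡ (*-congˡ (*-congʳ (-‿homo c)))) (*-congˡ (+-congˡ (sum≈eval n a z))) ⟨
    eval qs z + z ^ k * (embed (ℚ.- c) * eval (tabulate a) z) + embed c * z ^ k * monic n a z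
      ≈⟨ +-congʳ (trans (eval-⊞ qs _ z) (+-congˡ (trans (eval-shifts k _ z)
           (*-congˡ (eval-scale (ℚ.- c) (tabulate a) z))))) ⟨
    eval (reduce n a k qs c) z + embed c * z ^ k * monic n a z ∎

  module _ {β γ : Carrier} {n : ℕ} {a : Vector ℚ n} (root-β : monic n a β ≈ 0#) (root-γ : monic n a γ ≈ 0#)
    (minimal : ∀ k (b : Vector ℚ k) → monic k b β ≈ 0# → n ℕ.≤ k) where

    private
      -- Division by the minimal polynomial, one leading coefficient at a time. A zero leading
      -- coefficient is dropped; a nonzero one forces degree at least n by minimality, so `reduce`
      -- applies and keeps the values at both β and γ. The bound k on the length makes the recursion
      -- structural, since the reduced list is not a sublist.
      conjugate : ∀ k qs → length qs ℕ.≤ k → eval qs β ≈ 0# → eval qs γ ≈ 0#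
      conjugate-∷ʳ : ∀ k qs c → Dec (c ≡ 0ℚ) → length qs ℕ.≤ k → eval (qs ∷ʳ c) β ≈ 0# → eval (qs ∷ʳ c) γ ≈ 0#

      conjugate k qs len qs-β with initLast qs
      conjugate k       .[]        len qs-β | []        = refl
      conjugate zero    .(qs ∷ʳ c) len qs-β | qs ∷ʳ′ c with () ← ≡.subst (ℕ._≤ 0) (length-∷ʳ c qs) len
      conjugate (suc k) .(qs ∷ʳ c) len qs-β | qs ∷ʳ′ c =
        conjugate-∷ʳ k qs c (c ℚ.≟ 0ℚ) (ℕ.s≤s⁻¹ (≡.subst (ℕ._≤ suc k) (length-∷ʳ c qs) len)) qs-β

      conjugate-∷ʳ k qs c (yes ≡.refl) len qs-β = trans (drop-0 γ) (conjugate k qs len (trans (sym (drop-0 β)) qs-β))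
        where
        drop-0 : ∀ z → eval (qs ∷ʳ 0ℚ) z ≈ eval qs z
        drop-0 z = trans (eval-∷ʳ qs 0ℚ z)
          (trans (+-congˡ (trans (*-congʳ 0#-homo) (zeroˡ _))) (+-identityʳ _))
      conjugate-∷ʳ k qs c (no c≢0) len qs-β = begin
        eval (qs ∷ʳ c) γ                                 ≈⟨ drop-leading γ root-γ ⟩
        eval (reduce n a (length qs ∸ n) qs c) γ         ≈⟨ conjugate k (reduce n a (length qs ∸ n) qs c)
                                                              (ℕ.≤-trans (length-reduce n a (length qs ∸ n) qs c (≡.sym m∸n+n≡m))
                                                                (ℕ.≤-trans (ℕ.≤-reflexive m∸n+n≡m) len))
                                                              (trans (sym (drop-leading β root-β)) qs-β) ⟩
        0#                                               ∎
        where
        instance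
          c-nonZero : ℚ.NonZero c
          c-nonZero = ℚ.≢-nonZero c≢0
        -- Division by c yields a monic polynomial of degree `length qs` with root β.
        n≤length : n ℕ.≤ length qs
        n≤length = minimal (length qs) (λ i → ℚ.1/ c ℚ.* lookup qs i)
          (trans (monic-normalisation qs {c} {d = ℚ.1/ c} (ℚ.*-inverseˡ c) β) (trans (*-congˡ qs-β) (zeroʳ _)))
        m∸n+n≡m : length qs ∸ n ℕ.+ n ≡ length qs
        m∸n+n≡m = ℕ.m∸n+n≡m n≤length
        drop-leading : ∀ z → monic n a z ≈ 0# → eval (qs ∷ʳ c) z ≈ eval (reduce n a (length qs ∸ n) qs c) z
        drop-leading z root = trans (eval-reduce n a (length qs ∸ n) qs c z (≡.sym m∸n+n≡m))
          (trans (+-congˡ (trans (*-congˡ root) (zeroʳ _))) (+-identityʳ _))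

    conjugate-root : ∀ {F} → IsPolynomial F → F β ≈ 0# → F γ ≈ 0#
    conjugate-root (qs , F≈) F-β = trans (F≈ γ) (conjugate (length qs) qs ℕ.≤-refl (trans (sym (F≈ β)) F-β))

-- Absence of zero divisors among pairs a + b i

module ComplexNorm (A : OrderedℚAlgebra) where

  open OrderedℚAlgebra A
  open OrderedℚAlgebraProperties A
  open Solver using (solve; _:+_; _:*_; _:-_; :-_; _:=_; con)
  open Relation.Binary.Reasoning.Setoid setoid

  norm-nonPos⇒≈0 : ∀ {a b} → NonNeg (- (a * a + b * b)) → a ≈ 0# × b ≈ 0#
  norm-nonPos⇒≈0 {a} {b} N≤0 =
      sq-nonPos⇒≈0 (nonNeg-resp (solve 2 (λ x y → :- (x :+ y) :+ y := :- x) refl (a * a) (b * b))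
        (nonNeg-+ N≤0 (nonNeg-sq b)))
    , sq-nonPos⇒≈0 (nonNeg-resp (solve 2 (λ x y → :- (x :+ y) :+ x := :- y) refl (a * a) (b * b))
        (nonNeg-+ N≤0 (nonNeg-sq a)))

  -- The norm is multiplicative, so (a² + b²)(c² + d²) ≈ 0. As a² + b² is only known not to be 0,
  -- `nonPos-of-product` gives c² + d² ≤ 0, which suffices because squares are nonnegative.
  zero-product : ∀ {a b c d} → ¬ (a ≈ 0# × b ≈ 0#) →
    a * c - b * d ≈ 0# → a * d + b * c ≈ 0# → c ≈ 0# × d ≈ 0#
  zero-product {a} {b} {c} {d} ab≉0 re≈0 im≈0 = norm-nonPos⇒≈0
    (nonPos-of-product (nonNeg-+ (nonNeg-sq a) (nonNeg-sq b))
      (λ N≈0 → ab≉0 (norm-nonPos⇒≈0 (nonNeg-resp (begin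
        embed 0ℚ             ≈⟨ solve 0 (con 0ℚ := :- con 0ℚ) refl ⟩
        - embed 0ℚ           ≈⟨ -‿cong (trans 0#-homo (sym N≈0)) ⟩
        - (a * a + b * b)    ∎) (nonNeg-const 0ℚ))))
      (begin
        (a * a + b * b) * (c * c + d * d)
          ≈⟨ solve 4 (λ a b c d → (a :* a :+ b :* b) :* (c :* c :+ d :* d)
               := (a :* c :- b :* d) :* (a :* c :- b :* d) :+ (a :* d :+ b :* c) :* (a :* d :+ b :* c))
               refl a b c d ⟩
        (a * c - b * d) * (a * c - b * d) + (a * d + b * c) * (a * d + b * c)
          ≈⟨ +-cong (*-congʳ re≈0) (*-congʳ im≈0) ⟩
        0# * (a * c - b * d) + 0# * (a * d + b * c)
          ≈⟨ +-cong (zeroˡ _) (zeroˡ _) ⟩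
        0# + 0#
          ≈⟨ +-identityˡ 0# ⟩
        0# ∎))

-- Bounds and periodicity of the orbit of l

module Orbit (A : OrderedℚAlgebra) where

  open OrderedℚAlgebra A
  open OrderedℚAlgebraProperties A
  open Solver using (solve; _:+_; _:*_; _:-_; :-_; _:=_; con)
  open Relation.Binary.Reasoning.Setoid setoid

  -- Two orbits with the same digits differ by a bounded sequence that is
  -- multiplied by -β at each step.
  module _ {β l r : Carrier} {g : ℚ} (0<g : 0ℚ ℚ.< g) (β≥1+g : NonNeg (β - embed 1ℚ - embed g))
    (r≈l+1 : r ≈ l + embed 1ℚ) {t d : ℕ → Carrier}
    (t≥l : ∀ n → NonNeg (t n - l)) (t≤r : ∀ n → NonNeg (r - t n))
    (t-step : ∀ n → t (suc n) ≈ - β * t n - d n) where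

    orbit-periodic : ∀ m p → (∀ n → m ℕ.≤ n → d (n ℕ.+ p) ≈ d n) →
      ∀ n → m ℕ.≤ n → t (n ℕ.+ p) ≈ t n
    orbit-periodic m p d-per n m≤n = begin
      t (n ℕ.+ p)             ≈⟨ solve 2 (λ x y → x := x :- y :+ y) refl (t (n ℕ.+ p)) (t n) ⟩
      δ 0 + t n               ≈⟨ +-congʳ (sq-nonPos⇒≈0 (bounded-expanding⇒nonPos (λ k → δ k * δ k) (β * β) g
                                   0<g β²≥1+g (λ k → nonNeg-sq (δ k)) δ²-step δ²≤1)) ⟩
      0# + t n                ≈⟨ +-identityˡ (t n) ⟩
      t n                     ∎
      where
      δ : ℕ → Carrier
      -- Each step multiplies δ by -β, so its sign alternates. Its square is nonnegative, is
      -- multiplied by β² ≥ 1 + g, and stays at most 1 because both points lie in an interval of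
      -- length 1; hence it vanishes.
      δ k = t (k ℕ.+ n ℕ.+ p) - t (k ℕ.+ n)
      β²≥1+g : NonNeg (β * β - embed 1ℚ - embed g)
      β²≥1+g = nonNeg-resp
        (solve 2 (λ β g → (β :- con 1ℚ :- g) :* ((β :- con 1ℚ :- g) :+ con 2ℚ :+ g) :+ g :* ((β :- con 1ℚ :- g) :+ con 1ℚ :+ g)
            := β :* β :- con 1ℚ :- g) refl β (embed g))
        (nonNeg-+
          (nonNeg-* β≥1+g (nonNeg-+ (nonNeg-+ β≥1+g (nonNeg-const 2ℚ)) g≥0))
          (nonNeg-* g≥0 (nonNeg-+ (nonNeg-+ β≥1+g (nonNeg-const 1ℚ)) g≥0)))
        where
        g≥0 : NonNeg (embed g)
        g≥0 = nonNeg-embed (ℚ.<⇒≤ 0<g)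
      δ-step : ∀ k → δ (suc k) ≈ - β * δ k
      δ-step k = begin
        t (suc (k ℕ.+ n ℕ.+ p)) - t (suc (k ℕ.+ n))
          ≈⟨ +-cong (t-step (k ℕ.+ n ℕ.+ p)) (-‿cong (t-step (k ℕ.+ n))) ⟩
        - β * t (k ℕ.+ n ℕ.+ p) - d (k ℕ.+ n ℕ.+ p) - (- β * t (k ℕ.+ n) - d (k ℕ.+ n))
          ≈⟨ +-congʳ (+-congˡ (-‿cong (d-per (k ℕ.+ n) (ℕ.≤-trans m≤n (ℕ.m≤n+m n k))))) ⟩
        - β * t (k ℕ.+ n ℕ.+ p) - d (k ℕ.+ n) - (- β * t (k ℕ.+ n) - d (k ℕ.+ n))
          ≈⟨ solve 4 (λ β x y d → :- β :* x :- d :- (:- β :* y :- d) := :- β :* (x :- y))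
               refl β (t (k ℕ.+ n ℕ.+ p)) (t (k ℕ.+ n)) (d (k ℕ.+ n)) ⟩
        - β * δ k ∎
      δ²-step : ∀ k → δ (suc k) * δ (suc k) ≈ β * β * (δ k * δ k)
      δ²-step k = trans (*-cong (δ-step k) (δ-step k))
        (solve 2 (λ β x → (:- β :* x) :* (:- β :* x) := β :* β :* (x :* x)) refl β (δ k))
      δ²≤1 : ∀ k → NonNeg (embed 1ℚ - δ k * δ k)
      δ²≤1 k = nonNeg-resp (begin
          ((r - x) + (y - l)) * ((r - y) + (x - l))
            ≈⟨ *-cong (+-congʳ (+-congʳ r≈l+1)) (+-congʳ (+-congʳ r≈l+1)) ⟩
          ((l + embed 1ℚ - x) + (y - l)) * ((l + embed 1ℚ - y) + (x - l))
            ≈⟨ solve 3 (λ x y l → ((l :+ con 1ℚ :- x) :+ (y :- l)) :* ((l :+ con 1ℚ :- y) :+ (x :- l))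
                 := con 1ℚ :- (x :- y) :* (x :- y)) refl x y l ⟩
          embed 1ℚ - (x - y) * (x - y) ∎)
        (nonNeg-* (nonNeg-+ (t≤r (k ℕ.+ n ℕ.+ p)) (t≥l (k ℕ.+ n))) (nonNeg-+ (t≤r (k ℕ.+ n)) (t≥l (k ℕ.+ n ℕ.+ p))))
        where
        x y : Carrier
        x = t (k ℕ.+ n ℕ.+ p)
        y = t (k ℕ.+ n)

  -- Subtracting the floor k from -β t - l leaves a number in [0, 1), and this number is t′ - l.
  step-bounds : ∀ {β l r t t′ k} g → 0ℚ ℚ.< g → r ≈ l + embed 1ℚ → t′ ≈ - β * t - k →
    NonNeg (- β * t - l - k) → NonNeg (k + embed 1ℚ - (- β * t - l) - embed g) →
    NonNeg (t′ - l) × NonNeg (r - t′)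
  step-bounds {β} {l} {r} {t} {t′} {k} g 0<g r≈l+1 t′≈ k≤ <k+1 =
      nonNeg-resp (begin
        - β * t - l - k       ≈⟨ solve 3 (λ x l k → x :- l :- k := x :- k :- l) refl (- β * t) l k ⟩
        - β * t - k - l       ≈⟨ +-congʳ t′≈ ⟨
        t′ - l                ∎) k≤
    , nonNeg-resp (begin
        k + embed 1ℚ - (- β * t - l) - embed g + embed g
          ≈⟨ solve 4 (λ x l k g → k :+ con 1ℚ :- (x :- l) :- g :+ g := l :+ con 1ℚ :- (x :- k))
               refl (- β * t) l k (embed g) ⟩
        l + embed 1ℚ - (- β * t - k)
          ≈⟨ +-cong r≈l+1 (-‿cong t′≈) ⟨
        r - t′ ∎) (nonNeg-+ <k+1 (nonNeg-embed (ℚ.<⇒≤ 0<g)))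

  start-bounds : ∀ {l r t} → r ≈ l + embed 1ℚ → t ≈ l → NonNeg (t - l) × NonNeg (r - t)
  start-bounds {l} {r} {t} r≈l+1 t≈l =
      nonNeg-resp (begin
        embed 0ℚ           ≈⟨ solve 1 (λ l → con 0ℚ := l :- l) refl l ⟩
        l - l              ≈⟨ +-congʳ t≈l ⟨
        t - l              ∎) (nonNeg-const 0ℚ)
    , nonNeg-resp (begin
        embed 1ℚ           ≈⟨ solve 1 (λ l → con 1ℚ := l :+ con 1ℚ :- l) refl l ⟩
        l + embed 1ℚ - l   ≈⟨ +-cong r≈l+1 (-‿cong t≈l) ⟨
        r - t              ∎) (nonNeg-const 1ℚ)

  complement : ∀ {l r t} → r ≈ l + embed 1ℚ → t - l ≈ embed 1ℚ - (r - t)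
  complement {l} {r} {t} r≈l+1 = trans
    (solve 2 (λ l t → t :- l := con 1ℚ :- (l :+ con 1ℚ :- t)) refl l t)
    (+-congˡ (-‿cong (+-congʳ (sym r≈l+1))))

-- Identities for complex arithmetic by components, and for l and r

module RingIdentities (A : ℚ-Algebra) where

  open ℚ-Algebra A
  open Solver using (solve; _:+_; _:*_; _:-_; :-_; _:=_; con)

  assoc-re : ∀ a b c d e f → (a * c - b * d) * e - (a * d + b * c) * f ≈ a * (c * e - d * f) - b * (c * f + d * e)
  assoc-re = solve 6 (λ a b c d e f →
    (a :* c :- b :* d) :* e :- (a :* d :+ b :* c) :* f := a :* (c :* e :- d :* f) :- b :* (c :* f :+ d :* e)) refl

  assoc-im : ∀ a b c d e f → (a * c - b * d) * f + (a * d + b * c) * e ≈ a * (c * f + d * e) + b * (c * e - d * f)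
  assoc-im = solve 6 (λ a b c d e f →
    (a :* c :- b :* d) :* f :+ (a :* d :+ b :* c) :* e := a :* (c :* f :+ d :* e) :+ b :* (c :* e :- d :* f)) refl

  comm-re : ∀ a b c d → a * c - b * d ≈ c * a - d * b
  comm-re = solve 4 (λ a b c d → a :* c :- b :* d := c :* a :- d :* b) refl

  comm-im : ∀ a b c d → a * d + b * c ≈ c * b + d * a
  comm-im = solve 4 (λ a b c d → a :* d :+ b :* c := c :* b :+ d :* a) refl

  distribˡ-re : ∀ a b c d e f → a * (c + e) - b * (d + f) ≈ (a * c - b * d) + (a * e - b * f)
  distribˡ-re = solve 6 (λ a b c d e f →
    a :* (c :+ e) :- b :* (d :+ f) := (a :* c :- b :* d) :+ (a :* e :- b :* f)) refl

  distribˡ-im : ∀ a b c d e f → a * (d + f) + b * (c + e) ≈ (a * d + b * c) + (a * f + b * e)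
  distribˡ-im = solve 6 (λ a b c d e f →
    a :* (d :+ f) :+ b :* (c :+ e) := (a :* d :+ b :* c) :+ (a :* f :+ b :* e)) refl

  identityˡ-re : ∀ a b → embed 1ℚ * a - embed 0ℚ * b ≈ a
  identityˡ-re = solve 2 (λ a b → con 1ℚ :* a :- con 0ℚ :* b := a) refl

  identityˡ-im : ∀ a b → embed 1ℚ * b + embed 0ℚ * a ≈ b
  identityˡ-im = solve 2 (λ a b → con 1ℚ :* b :+ con 0ℚ :* a := b) refl

  real-*-re : ∀ a c → a * c ≈ a * c - embed 0ℚ * embed 0ℚ
  real-*-re = solve 2 (λ a c → a :* c := a :* c :- con 0ℚ :* con 0ℚ) refl

  real-*-im : ∀ a c → embed 0ℚ ≈ a * embed 0ℚ + embed 0ℚ * c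
  real-*-im = solve 2 (λ a c → con 0ℚ := a :* con 0ℚ :+ con 0ℚ :* c) refl

  0≈0+0 : embed 0ℚ ≈ embed 0ℚ + embed 0ℚ
  0≈0+0 = solve 0 (con 0ℚ := con 0ℚ :+ con 0ℚ) refl

  0≈-0 : embed 0ℚ ≈ - embed 0ℚ
  0≈-0 = solve 0 (con 0ℚ := :- con 0ℚ) refl

  step-im : ∀ x → x + (embed 0ℚ - embed 0ℚ) ≈ x
  step-im = solve 1 (λ x → x :+ (con 0ℚ :- con 0ℚ) := x) refl

  norm-neg : ∀ a c q → a * a + c * c - embed q ≈ (- a) * (- a) + (- c) * (- c) - embed q
  norm-neg a c q = +-congʳ (solve 2 (λ a c → a :* a :+ c :* c := :- a :* :- a :+ :- c :* :- c) refl a c)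

  -x≈-βx : ∀ β x → - (β * x) ≈ - β * x
  -x≈-βx = solve 2 (λ β x → :- (β :* x) := :- β :* x) refl

  r≈1-βr : ∀ {β r} → (β + embed 1ℚ) * r ≈ embed 1ℚ → r ≈ - (β * r) + embed 1ℚ
  r≈1-βr {β} {r} eq = trans
    (solve 2 (λ β r → r := :- (β :* r) :+ (β :+ con 1ℚ) :* r) refl β r) (+-congˡ eq)

  x-[x-1]≈1 : ∀ {l r} → r ≈ l + embed 1ℚ → r - l ≈ embed 1ℚ
  x-[x-1]≈1 {l} {r} r≈ = trans (+-congʳ r≈) (solve 1 (λ l → l :+ con 1ℚ :- l := con 1ℚ) refl l)

  difference≈0 : ∀ {x y} → x - y ≈ 0# → x ≈ y
  difference≈0 {x} {y} x-y≈0 = trans (solve 2 (λ x y → x := x :- y :+ y) refl x y)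
    (trans (+-congʳ x-y≈0) (+-identityˡ y))

  difference-of-negations : ∀ {γ β} → - γ - - β ≈ 0# → γ ≈ β
  difference-of-negations {γ} {β} eq = trans
    (solve 2 (λ γ β → γ := β :- (:- γ :- :- β)) refl γ β)
    (trans (+-congˡ (-‿cong (trans eq (sym 0#-homo)))) (solve 1 (λ β → β :- con 0ℚ := β) refl β))

open +-*-Solver using (solve; _:+_; _:*_; _:-_; :-_; _:=_; con)

-- Rational inequalities

<-by : ∀ {p q e} → 0ℚ ℚ.< e → q ℚ.- p ≡ e → p ℚ.< q
<-by {p} {q} {e} 0<e q-p≡e = ≡.subst₂ ℚ._<_ (ℚ.+-identityˡ p)
  (≡.trans (≡.cong (ℚ._+ p) (≡.sym q-p≡e)) (solve 2 (λ p q → q :- p :+ p := q) ≡.refl p q))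
  (ℚ.+-monoˡ-< p 0<e)

p<q⇒0<q-p : ∀ {p q} → p ℚ.< q → 0ℚ ℚ.< q ℚ.- p
p<q⇒0<q-p {p} {q} p<q = ≡.subst (ℚ._< q ℚ.- p) (ℚ.+-inverseʳ p) (ℚ.+-monoˡ-< (ℚ.- p) p<q)

0<-by : ∀ {p e} → 0ℚ ℚ.< e → e ≡ p → 0ℚ ℚ.< p
0<-by 0<e ≡.refl = 0<e

0≤+ : ∀ {p q} → 0ℚ ℚ.≤ p → 0ℚ ℚ.≤ q → 0ℚ ℚ.≤ p ℚ.+ q
0≤+ {p} {q} = ℚ.+-mono-≤ {0ℚ} {p} {0ℚ} {q}

0<+ : ∀ {p q} → 0ℚ ℚ.< p → 0ℚ ℚ.< q → 0ℚ ℚ.< p ℚ.+ q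
0<+ {p} {q} = ℚ.+-mono-< {0ℚ} {p} {0ℚ} {q}

0<+≤ : ∀ {p q} → 0ℚ ℚ.< p → 0ℚ ℚ.≤ q → 0ℚ ℚ.< p ℚ.+ q
0<+≤ {p} {q} = ℚ.+-mono-<-≤ {0ℚ} {p} {0ℚ} {q}

0≤* : ∀ {p q} → 0ℚ ℚ.≤ p → 0ℚ ℚ.≤ q → 0ℚ ℚ.≤ p ℚ.* q
0≤* {p} {q} 0≤p 0≤q = ℚ.nonNegative⁻¹ (p ℚ.* q) {{ℚ.nonNeg*nonNeg⇒nonNeg p {{ℚ.nonNegative 0≤p}} q {{ℚ.nonNegative 0≤q}}}}

0<* : ∀ {p q} → 0ℚ ℚ.< p → 0ℚ ℚ.< q → 0ℚ ℚ.< p ℚ.* q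
0<* {p} {q} 0<p 0<q = ℚ.positive⁻¹ (p ℚ.* q) {{ℚ.pos*pos⇒pos p {{ℚ.positive 0<p}} q {{ℚ.positive 0<q}}}}

p≤0⇒0≤-p : ∀ {p} → p ℚ.≤ 0ℚ → 0ℚ ℚ.≤ ℚ.- p
p≤0⇒0≤-p = ℚ.neg-antimono-≤

p≤∣p∣ : ∀ p → p ℚ.≤ ℚ.∣ p ∣
p≤∣p∣ p with ℚ.≤-total 0ℚ p
... | inj₁ 0≤p = ℚ.≤-reflexive (≡.sym (ℚ.0≤p⇒∣p∣≡p 0≤p))
... | inj₂ p≤0 = ℚ.≤-trans p≤0 (ℚ.0≤∣p∣ p)

∣p∣<q⇒p<q : ∀ p {q} → ℚ.∣ p ∣ ℚ.< q → p ℚ.< q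
∣p∣<q⇒p<q p = ℚ.≤-<-trans (p≤∣p∣ p)

∣p-q∣≡∣q-p∣ : ∀ p q → ℚ.∣ p ℚ.- q ∣ ≡ ℚ.∣ q ℚ.- p ∣
∣p-q∣≡∣q-p∣ p q = ≡.trans (≡.sym (ℚ.∣-p∣≡∣p∣ (p ℚ.- q)))
  (≡.cong ℚ.∣_∣ (solve 2 (λ p q → :- (p :- q) := q :- p) ≡.refl p q))

scale : ∀ {C ε} → 0ℚ ℚ.< C → 0ℚ ℚ.< ε → ∃[ δ ] 0ℚ ℚ.< δ × C ℚ.* δ ≡ ε
scale 0<C 0<ε =
  let (δ , 0<δ , eq) = split 0<C 0<ε
  in δ ℚ.+ δ , 0<+ {δ} {δ} 0<δ 0<δ , eq

half : ∀ {ε} → 0ℚ ℚ.< ε → ∃[ δ ] 0ℚ ℚ.< δ × δ ℚ.+ δ ≡ ε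
half 0<ε =
  let (δ , 0<δ , eq) = split 0<1 0<ε
  in δ , 0<δ , ≡.trans (≡.sym (ℚ.*-identityˡ (δ ℚ.+ δ))) eq

-- Cauchy reals as an ordered ring

≗⇒≈ᴿ : ∀ {x y} → (∀ n → seq x n ≡ seq y n) → x ≈ᴿ y
≗⇒≈ᴿ {x} x≗y = mk≈ λ ε 0<ε → 0 , λ n _ →
  ≡.subst (ℚ._< ε) (≡.trans (≡.sym (∣p-p∣≡0 (seq x n))) (≡.cong (λ q → ℚ.∣ seq x n ℚ.- q ∣) (x≗y n))) 0<ε

≈ᴿ-refl : Reflexive _≈ᴿ_
≈ᴿ-refl = ≗⇒≈ᴿ λ _ → ≡.refl

≈ᴿ-sym : Symmetric _≈ᴿ_
≈ᴿ-sym {x} {y} (mk≈ x~y) = mk≈ λ ε 0<ε → let (N , p) = x~y ε 0<ε in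
  N , λ n N≤n → ≡.subst (ℚ._< ε) (∣p-q∣≡∣q-p∣ (seq x n) (seq y n)) (p n N≤n)

∣sum∣< : ∀ p q {δ ε r} → r ≡ p ℚ.+ q → δ ℚ.+ δ ≡ ε → ℚ.∣ p ∣ ℚ.< δ → ℚ.∣ q ∣ ℚ.< δ → ℚ.∣ r ∣ ℚ.< ε
∣sum∣< p q ≡.refl ≡.refl p<δ q<δ = ℚ.≤-<-trans (ℚ.∣p+q∣≤∣p∣+∣q∣ p q) (ℚ.+-mono-< p<δ q<δ)

≈ᴿ-trans : Transitive _≈ᴿ_
≈ᴿ-trans {x} {y} {z} (mk≈ x~y) (mk≈ y~z) = mk≈ λ ε 0<ε →
  let (δ , 0<δ , eq) = half 0<ε
      (M , p) = x~y δ 0<δ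
      (N , q) = y~z δ 0<δ
  in M ℕ.+ N , λ n M+N≤n → ∣sum∣< (seq x n ℚ.- seq y n) (seq y n ℚ.- seq z n)
    (solve 3 (λ x y z → x :- z := (x :- y) :+ (y :- z)) ≡.refl (seq x n) (seq y n) (seq z n))
    eq (p n (ℕ.m+n≤o⇒m≤o M M+N≤n)) (q n (ℕ.m+n≤o⇒n≤o M M+N≤n))

+ᴿ-cong : ∀ {x x′ y y′} → x ≈ᴿ x′ → y ≈ᴿ y′ → x ℝ-Ring.+ y ≈ᴿ x′ ℝ-Ring.+ y′
+ᴿ-cong {x} {x′} {y} {y′} (mk≈ x~) (mk≈ y~) = mk≈ λ ε 0<ε →
  let (δ , 0<δ , eq) = half 0<ε
      (M , p) = x~ δ 0<δ
      (N , q) = y~ δ 0<δ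
  in M ℕ.+ N , λ n M+N≤n → ∣sum∣< (seq x n ℚ.- seq x′ n) (seq y n ℚ.- seq y′ n)
    (solve 4 (λ x x′ y y′ → x :+ y :- (x′ :+ y′) := (x :- x′) :+ (y :- y′)) ≡.refl
      (seq x n) (seq x′ n) (seq y n) (seq y′ n))
    eq (p n (ℕ.m+n≤o⇒m≤o M M+N≤n)) (q n (ℕ.m+n≤o⇒n≤o M M+N≤n))

-ᴿ-cong : ∀ {x x′} → x ≈ᴿ x′ → ℝ-Ring.- x ≈ᴿ ℝ-Ring.- x′
-ᴿ-cong {x} {x′} (mk≈ x~) = mk≈ λ ε 0<ε → let (N , p) = x~ ε 0<ε in
  N , λ n N≤n → ≡.subst (ℚ._< ε)
    (≡.trans (∣p-q∣≡∣q-p∣ (seq x n) (seq x′ n))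
      (≡.cong ℚ.∣_∣ (solve 2 (λ x x′ → x′ :- x := :- x :- :- x′) ≡.refl (seq x n) (seq x′ n))))
    (p n N≤n)

*ᴿ-comm : ∀ x y → x ℝ-Ring.* y ≈ᴿ y ℝ-Ring.* x
*ᴿ-comm x y = ≗⇒≈ᴿ λ n → ℚ.*-comm (seq x n) (seq y n)

*ᴿ-congʳ : ∀ {x x′} y → x ≈ᴿ x′ → x ℝ-Ring.* y ≈ᴿ x′ ℝ-Ring.* y
*ᴿ-congʳ {x} {x′} y (mk≈ x~) = mk≈ λ ε 0<ε →
  let (B , 0<B , M , bound) = bounded (seq y) (cauchy y)
      (δ , 0<δ , eq) = scale 0<B 0<ε
      (N , p) = x~ δ 0<δ
  in M ℕ.+ N , λ n M+N≤n → begin-strict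
    ℚ.∣ seq x n ℚ.* seq y n ℚ.- seq x′ n ℚ.* seq y n ∣
      ≡⟨ ≡.cong ℚ.∣_∣ (solve 3 (λ x x′ y → x :* y :- x′ :* y := (x :- x′) :* y) ≡.refl
           (seq x n) (seq x′ n) (seq y n)) ⟩
    ℚ.∣ (seq x n ℚ.- seq x′ n) ℚ.* seq y n ∣
      ≡⟨ ℚ.∣p*q∣≡∣p∣*∣q∣ (seq x n ℚ.- seq x′ n) (seq y n) ⟩
    ℚ.∣ seq x n ℚ.- seq x′ n ∣ ℚ.* ℚ.∣ seq y n ∣
      ≤⟨ ℚ.*-monoˡ-≤-nonNeg ℚ.∣ seq x n ℚ.- seq x′ n ∣ {{ℚ.∣-∣-nonNeg (seq x n ℚ.- seq x′ n)}}
           {ℚ.∣ seq y n ∣} {B}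
           (bound n (ℕ.m+n≤o⇒m≤o M M+N≤n)) ⟩
    ℚ.∣ seq x n ℚ.- seq x′ n ∣ ℚ.* B
      <⟨ ℚ.*-monoˡ-<-pos B {{ℚ.positive 0<B}} (p n (ℕ.m+n≤o⇒n≤o M M+N≤n)) ⟩
    δ ℚ.* B
      ≡⟨ ℚ.*-comm δ B ⟩
    B ℚ.* δ
      ≡⟨ eq ⟩
    ε ∎
  where open ℚ.≤-Reasoning

*ᴿ-cong : ∀ {x x′ y y′} → x ≈ᴿ x′ → y ≈ᴿ y′ → x ℝ-Ring.* y ≈ᴿ x′ ℝ-Ring.* y′
*ᴿ-cong {x} {x′} {y} {y′} x≈ y≈ = ≈ᴿ-trans (*ᴿ-congʳ y x≈)
  (≈ᴿ-trans (*ᴿ-comm x′ y) (≈ᴿ-trans (*ᴿ-congʳ x′ y≈) (*ᴿ-comm y′ x′)))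

ℝ-commutativeRing : CommutativeRing 0ℓ 0ℓ
ℝ-commutativeRing = record
  { Carrier = ℝ
  ; _≈_ = _≈ᴿ_
  ; _+_ = ℝ-Ring._+_
  ; _*_ = ℝ-Ring._*_
  ; -_ = ℝ-Ring.-_
  ; 0# = ℝ-Ring.0#
  ; 1# = ℝ-Ring.1#
  ; isCommutativeRing = record
    { isRing = record
      { +-isAbelianGroup = record
        { isGroup = record
          { isMonoid = record
            { isSemigroup = record
              { isMagma = record
                { isEquivalence = record { refl = ≈ᴿ-refl ; sym = ≈ᴿ-sym ; trans = ≈ᴿ-trans }
                ; ∙-cong = +ᴿ-cong
                }
              ; assoc = λ x y z → ≗⇒≈ᴿ λ n → ℚ.+-assoc (seq x n) (seq y n) (seq z n)
              }
            ; identity = (λ x → ≗⇒≈ᴿ λ n → ℚ.+-identityˡ (seq x n))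
                       , (λ x → ≗⇒≈ᴿ λ n → ℚ.+-identityʳ (seq x n))
            }
          ; inverse = (λ x → ≗⇒≈ᴿ λ n → ℚ.+-inverseˡ (seq x n))
                    , (λ x → ≗⇒≈ᴿ λ n → ℚ.+-inverseʳ (seq x n))
          ; ⁻¹-cong = -ᴿ-cong
          }
        ; comm = λ x y → ≗⇒≈ᴿ λ n → ℚ.+-comm (seq x n) (seq y n)
        }
      ; *-cong = *ᴿ-cong
      ; *-assoc = λ x y z → ≗⇒≈ᴿ λ n → ℚ.*-assoc (seq x n) (seq y n) (seq z n)
      ; *-identity = (λ x → ≗⇒≈ᴿ λ n → ℚ.*-identityˡ (seq x n))
                   , (λ x → ≗⇒≈ᴿ λ n → ℚ.*-identityʳ (seq x n))
      ; distrib = (λ x y z → ≗⇒≈ᴿ λ n → ℚ.*-distribˡ-+ (seq x n) (seq y n) (seq z n))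
                , (λ x y z → ≗⇒≈ᴿ λ n → ℚ.*-distribʳ-+ (seq x n) (seq y n) (seq z n))
      }
    ; *-comm = *ᴿ-comm
    }
  }

ℝ-algebra : ℚ-Algebra
ℝ-algebra = record
  { commutativeRing = ℝ-commutativeRing
  ; embed = fromℚ
  ; isRingHomomorphism = record
    { isSemiringHomomorphism = record
      { isNearSemiringHomomorphism = record
        { +-isMonoidHomomorphism = record
          { isMagmaHomomorphism = record
            { isRelHomomorphism = record { cong = λ { ≡.refl → ≈ᴿ-refl } }
            ; homo = λ _ _ → ≗⇒≈ᴿ λ _ → ≡.refl
            }
          ; ε-homo = ≈ᴿ-refl
          }
        ; *-homo = λ _ _ → ≗⇒≈ᴿ λ _ → ≡.refl
        }
      ; 1#-homo = ≈ᴿ-refl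
      }
    ; -‿homo = λ _ → ≗⇒≈ᴿ λ _ → ≡.refl
    }
  }

-- A positive form of 0 ≤ x, with explicit eventual bounds. Sums and products can be estimated with
-- it directly, whereas `_≤ᴿ_` is a negation.
record NonNegᴿ (x : ℝ) : Set where
  constructor mkNonNeg
  field
    above : ∀ ε → 0ℚ ℚ.< ε → ∃[ N ] ∀ n → N ℕ.≤ n → ℚ.- ε ℚ.< seq x n

eventually-nonNeg : ∀ {x} N → (∀ n → N ℕ.≤ n → 0ℚ ℚ.≤ seq x n) → NonNegᴿ x
eventually-nonNeg N x≥0 = mkNonNeg λ ε 0<ε → N , λ n N≤n →
  ℚ.<-≤-trans (ℚ.neg-antimono-< 0<ε) (x≥0 n N≤n)

nonNegᴿ-resp : ∀ {x y} → x ≈ᴿ y → NonNegᴿ x → NonNegᴿ y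
nonNegᴿ-resp {x} {y} (mk≈ x~y) (mkNonNeg x≥0) = mkNonNeg λ ε 0<ε →
  let (δ , 0<δ , eq) = half 0<ε
      (M , p) = x~y δ 0<δ
      (N , q) = x≥0 δ 0<δ
  in M ℕ.+ N , λ n M+N≤n → <-by
    (0<+ (p<q⇒0<q-p (∣p∣<q⇒p<q (seq x n ℚ.- seq y n) (p n (ℕ.m+n≤o⇒m≤o M M+N≤n))))
         (p<q⇒0<q-p (q n (ℕ.m+n≤o⇒n≤o M M+N≤n))))
    (≡.trans
      (≡.cong (λ ε → seq y n ℚ.- ℚ.- ε) (≡.sym eq))
      (solve 3 (λ x y d → y :- :- (d :+ d) := (d :- (x :- y)) :+ (x :- :- d)) ≡.refl (seq x n) (seq y n) δ))

nonNegᴿ-+ : ∀ {x y} → NonNegᴿ x → NonNegᴿ y → NonNegᴿ (x ℝ-Ring.+ y)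
nonNegᴿ-+ {x} {y} (mkNonNeg x≥0) (mkNonNeg y≥0) = mkNonNeg λ ε 0<ε →
  let (δ , 0<δ , eq) = half 0<ε
      (M , p) = x≥0 δ 0<δ
      (N , q) = y≥0 δ 0<δ
  in M ℕ.+ N , λ n M+N≤n → <-by
    (0<+ (p<q⇒0<q-p (p n (ℕ.m+n≤o⇒m≤o M M+N≤n))) (p<q⇒0<q-p (q n (ℕ.m+n≤o⇒n≤o M M+N≤n))))
    (≡.trans
      (≡.cong (λ ε → seq x n ℚ.+ seq y n ℚ.- ℚ.- ε) (≡.sym eq))
      (solve 3 (λ x y d → x :+ y :- :- (d :+ d) := (x :- :- d) :+ (y :- :- d)) ≡.refl (seq x n) (seq y n) δ))

-- If q ≥ 0, then p q = (p + δ) q - δ q ≥ -δ B, and symmetrically for p ≥ 0. Two nonpositive factors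
-- have a nonnegative product.
product-lower-bound : ∀ {p q A B δ} → 0ℚ ℚ.< A → 0ℚ ℚ.< B → 0ℚ ℚ.< δ → ℚ.∣ p ∣ ℚ.≤ A → ℚ.∣ q ∣ ℚ.≤ B →
  ℚ.- δ ℚ.< p → ℚ.- δ ℚ.< q → ℚ.- ((A ℚ.+ B) ℚ.* δ) ℚ.< p ℚ.* q
product-lower-bound {p} {q} {A} {B} {δ} 0<A 0<B 0<δ p≤A q≤B -δ<p -δ<q
  with ℚ.≤-total 0ℚ q | ℚ.≤-total 0ℚ p
... | inj₁ 0≤q | _ = <-by
  (0<+≤ (0<* 0<A 0<δ) (0≤+ (0≤* (p≤q⇒0≤q-p (ℚ.<⇒≤ -δ<p)) 0≤q)
    (0≤* (p≤q⇒0≤q-p (ℚ.≤-trans (p≤∣p∣ q) q≤B)) (ℚ.<⇒≤ 0<δ))))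
  (solve 5 (λ p q A B d → p :* q :- :- ((A :+ B) :* d) := A :* d :+ ((p :- :- d) :* q :+ (B :- q) :* d))
    ≡.refl p q A B δ)
... | inj₂ q≤0 | inj₁ 0≤p = <-by
  (0<+≤ (0<* 0<B 0<δ) (0≤+ (0≤* 0≤p (p≤q⇒0≤q-p (ℚ.<⇒≤ -δ<q)))
    (0≤* (p≤q⇒0≤q-p (ℚ.≤-trans (p≤∣p∣ p) p≤A)) (ℚ.<⇒≤ 0<δ))))
  (solve 5 (λ p q A B d → p :* q :- :- ((A :+ B) :* d) := B :* d :+ (p :* (q :- :- d) :+ (A :- p) :* d))
    ≡.refl p q A B δ)
... | inj₂ q≤0 | inj₂ p≤0 = <-by
  (0<+≤ (0<* (0<+ 0<A 0<B) 0<δ) (0≤* (p≤0⇒0≤-p p≤0) (p≤0⇒0≤-p q≤0)))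
  (solve 5 (λ p q A B d → p :* q :- :- ((A :+ B) :* d) := (A :+ B) :* d :+ :- p :* :- q) ≡.refl p q A B δ)

nonNegᴿ-* : ∀ {x y} → NonNegᴿ x → NonNegᴿ y → NonNegᴿ (x ℝ-Ring.* y)
nonNegᴿ-* {x} {y} (mkNonNeg x≥0) (mkNonNeg y≥0) = mkNonNeg λ ε 0<ε →
  let (A , 0<A , M₁ , boundA) = bounded (seq x) (cauchy x)
      (B , 0<B , M₂ , boundB) = bounded (seq y) (cauchy y)
      (δ , 0<δ , eq) = scale (0<+ 0<A 0<B) 0<ε
      (N₁ , p) = x≥0 δ 0<δ
      (N₂ , q) = y≥0 δ 0<δ
  in (M₁ ℕ.+ M₂) ℕ.+ (N₁ ℕ.+ N₂) , λ n ≤n →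
    let M≤n = ℕ.m+n≤o⇒m≤o (M₁ ℕ.+ M₂) ≤n
        N≤n = ℕ.m+n≤o⇒n≤o (M₁ ℕ.+ M₂) ≤n
    in ≡.subst (λ e → ℚ.- e ℚ.< seq x n ℚ.* seq y n) eq
      (product-lower-bound 0<A 0<B 0<δ
        (boundA n (ℕ.m+n≤o⇒m≤o M₁ M≤n)) (boundB n (ℕ.m+n≤o⇒n≤o M₁ M≤n))
        (p n (ℕ.m+n≤o⇒m≤o N₁ N≤n)) (q n (ℕ.m+n≤o⇒n≤o N₁ N≤n)))

0≤p*p : ∀ p → 0ℚ ℚ.≤ p ℚ.* p
0≤p*p p with ℚ.≤-total 0ℚ p
... | inj₁ 0≤p = 0≤* 0≤p 0≤p
... | inj₂ p≤0 = ≡.subst (0ℚ ℚ.≤_) (solve 1 (λ p → :- p :* :- p := p :* p) ≡.refl p)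
  (0≤* (p≤0⇒0≤-p p≤0) (p≤0⇒0≤-p p≤0))

fromℚ-nonNeg : ∀ {q} → NonNegᴿ (fromℚ q) → 0ℚ ℚ.≤ q
fromℚ-nonNeg {q} (mkNonNeg q≥0) = ℚ.≮⇒≥ λ q<0 →
  let (N , p) = q≥0 (ℚ.- q) (ℚ.neg-antimono-< q<0)
  in ℚ.<-irrefl (solve 1 (λ q → :- :- q := q) ≡.refl q) (p N ℕ.≤-refl)

-- A single rational comparison at a Cauchy index N of precision γ = ε/4 decides. If x is at least
-- -2γ at N, all later terms exceed -3γ. Otherwise all later terms lie below -γ, which the
-- hypothesis refutes.
nonNegᴿ-stable : ∀ {x} → (∀ g → 0ℚ ℚ.< g → ¬ NonNegᴿ (ℝ-Ring.- x -ᴿ fromℚ g)) → NonNegᴿ x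
nonNegᴿ-stable {x} ¬x<0 = mkNonNeg λ ε 0<ε →
  let (δ , 0<δ , δ+δ≡ε) = half 0<ε
      (γ , 0<γ , γ+γ≡δ) = half 0<δ
      (N , close)       = cauchy x γ 0<γ
  in N , shrink (≡.trans (≡.cong₂ ℚ._+_ γ+γ≡δ γ+γ≡δ) δ+δ≡ε)
       (above γ 0<γ N close (ℚ.- (γ ℚ.+ γ) ℚ.≤? seq x N))
  where
  shrink : ∀ {δ ε N} → δ ≡ ε →
    (∀ n → N ℕ.≤ n → ℚ.- δ ℚ.< seq x n) → ∀ n → N ℕ.≤ n → ℚ.- ε ℚ.< seq x n
  shrink ≡.refl p = p
  above : ∀ γ → 0ℚ ℚ.< γ → ∀ N →
    (∀ m n → N ℕ.≤ m → N ℕ.≤ n → ℚ.∣ seq x m ℚ.- seq x n ∣ ℚ.< γ) →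
    Dec (ℚ.- (γ ℚ.+ γ) ℚ.≤ seq x N) →
    ∀ n → N ℕ.≤ n → ℚ.- ((γ ℚ.+ γ) ℚ.+ (γ ℚ.+ γ)) ℚ.< seq x n
  above γ 0<γ N close (yes -δ≤) n N≤n = <-by
    (0<+ (p<q⇒0<q-p (∣p∣<q⇒p<q (seq x N ℚ.- seq x n) (close N n ℕ.≤-refl N≤n)))
         (0<+≤ 0<γ (p≤q⇒0≤q-p -δ≤)))
    (solve 3 (λ x y g → x :- :- ((g :+ g) :+ (g :+ g)) := (g :- (y :- x)) :+ (g :+ (y :- :- (g :+ g))))
      ≡.refl (seq x n) (seq x N) γ)
  above γ 0<γ N close (no -δ≰) = contradiction
    (eventually-nonNeg {ℝ-Ring.- x -ᴿ fromℚ γ} N λ n N≤n → ℚ.<⇒≤ (0<-by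
      (0<+ (p<q⇒0<q-p (∣p∣<q⇒p<q (seq x n ℚ.- seq x N) (close n N N≤n ℕ.≤-refl)))
           (p<q⇒0<q-p (ℚ.≰⇒> -δ≰)))
      (solve 3 (λ x y g → (g :- (x :- y)) :+ (:- (g :+ g) :- y) := :- x :- g) ≡.refl (seq x n) (seq x N) γ)))
    (¬x<0 γ 0<γ)

nonNegᴿ-antisym : ∀ {x} → NonNegᴿ x → NonNegᴿ (ℝ-Ring.- x) → x ≈ᴿ ℝ-Ring.0#
nonNegᴿ-antisym {x} (mkNonNeg x≥0) (mkNonNeg -x≥0) = mk≈ λ ε 0<ε →
  let (M , p) = x≥0 ε 0<ε
      (N , q) = -x≥0 ε 0<ε
  in M ℕ.+ N , λ n M+N≤n → ∣p-q∣<ε {seq x n} {0ℚ}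
    (<-by (p<q⇒0<q-p (q n (ℕ.m+n≤o⇒n≤o M M+N≤n)))
      (solve 2 (λ x e → e :- (x :- con 0ℚ) := :- x :- :- e) ≡.refl (seq x n) ε))
    (<-by (p<q⇒0<q-p (p n (ℕ.m+n≤o⇒m≤o M M+N≤n)))
      (solve 2 (λ x e → e :- (con 0ℚ :- x) := x :- :- e) ≡.refl (seq x n) ε))

ℝ-ordered : OrderedℚAlgebra
ℝ-ordered = record
  { algebra        = ℝ-algebra
  ; NonNeg         = NonNegᴿ
  ; nonNeg-resp    = nonNegᴿ-resp
  ; nonNeg-+       = nonNegᴿ-+
  ; nonNeg-*       = nonNegᴿ-*
  ; nonNeg-sq      = λ x → eventually-nonNeg 0 λ n _ → 0≤p*p (seq x n)
  ; nonNeg-embed   = λ 0≤q → eventually-nonNeg 0 λ _ _ → 0≤q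
  ; embed-nonNeg   = fromℚ-nonNeg
  ; nonNeg-stable  = nonNegᴿ-stable
  ; nonNeg-antisym = nonNegᴿ-antisym
  }

<ᴿ⇒nonNeg : ∀ {x y} (x<y : x <ᴿ y) → NonNegᴿ (y -ᴿ x -ᴿ fromℚ (_<ᴿ_.gap x<y))
<ᴿ⇒nonNeg {x} {y} (mk< g _ N x+g<y) = eventually-nonNeg N λ n N≤n →
  ≡.subst (0ℚ ℚ.≤_) (solve 3 (λ x y g → y :- (x :+ g) := y :- x :- g) ≡.refl (seq x n) (seq y n) g)
    (p≤q⇒0≤q-p (ℚ.<⇒≤ (x+g<y n N≤n)))

-- If y ≤ x - g, half of g absorbs the error in the eventual bound and the other half is the gap of
-- y <ᴿ x.
≤ᴿ⇒nonNeg : ∀ {x y} → x ≤ᴿ y → NonNegᴿ (y -ᴿ x)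
≤ᴿ⇒nonNeg {x} {y} ¬y<x = nonNegᴿ-stable λ g 0<g y≤x-g →
  let (δ , 0<δ , δ+δ≡g) = half 0<g
  in contra 0<δ δ+δ≡g y≤x-g
  where
  contra : ∀ {δ g} → 0ℚ ℚ.< δ → δ ℚ.+ δ ≡ g → ¬ NonNegᴿ (ℝ-Ring.- (y -ᴿ x) -ᴿ fromℚ g)
  contra {δ} 0<δ ≡.refl (mkNonNeg above) = let (N , p) = above δ 0<δ in
    ¬y<x (mk< δ 0<δ N λ n N≤n → <-by (p<q⇒0<q-p (p n N≤n))
      (solve 3 (λ x y d → x :- (y :+ d) := (:- (y :- x) :- (d :+ d)) :- :- d) ≡.refl (seq x n) (seq y n) δ))

-- `recip` inverts x from index N on, re-indexed to start at 0. So x is first replaced by its shift,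
-- which is equal to it by the Cauchy property, and then the inverse is exact term by term.
recip-inverse : ∀ x (0<x : ℝ-Ring.0# <ᴿ x) → x ℝ-Ring.* recip x 0<x ≈ᴿ ℝ-Ring.1#
recip-inverse x 0<x@(mk< ε 0<ε N 0+ε<x) = ≈ᴿ-trans (*ᴿ-congʳ (recip x 0<x) x≈shift)
  (≗⇒≈ᴿ λ n → ℚ.*-inverseʳ (seq x (N ℕ.+ n)) {{nonZero n}})
  where
  nonZero : ∀ n → ℚ.NonZero (seq x (N ℕ.+ n))
  nonZero n = ℚ.pos⇒nonZero (seq x (N ℕ.+ n)) {{ℚ.positive (ℚ.<-trans 0<ε
    (≡.subst (ℚ._< seq x (N ℕ.+ n)) (ℚ.+-identityˡ ε) (0+ε<x (N ℕ.+ n) (ℕ.m≤m+n N n))))}}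
  x≈shift : x ≈ᴿ mkℝ (λ n → seq x (N ℕ.+ n)) (shift-isCauchy (seq x) N (cauchy x))
  x≈shift = mk≈ λ δ 0<δ → let (M , close) = cauchy x δ 0<δ in
    M , λ n M≤n → close n (N ℕ.+ n) M≤n (ℕ.≤-trans M≤n (ℕ.m≤n+m n N))

-- Cotransitivity: a Cauchy index of precision 1/32 tells whether ∣z∣ < 2 or ∣z∣ > 15/8.
∣z∣<2∨∣z∣²≥7/2 : ∀ z → ∣ z ∣ <ᴿ fromℤ (+ 2) ⊎
  NonNegᴿ (re z ℝ-Ring.* re z ℝ-Ring.+ im z ℝ-Ring.* im z -ᴿ fromℚ (+ 7 ℚ./ 2))
∣z∣<2∨∣z∣²≥7/2 z = decide (cauchy ∣ z ∣ 1/32 (ℚ.positive⁻¹ 1/32))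
  where
  1/32 31/16 15/8 7/2 2ℚ : ℚ
  1/32  = + 1 ℚ./ 32
  31/16 = + 31 ℚ./ 16
  15/8  = + 15 ℚ./ 8
  7/2   = + 7 ℚ./ 2
  2ℚ    = + 2 ℚ./ 1
  v n² : ℕ → ℚ
  v = seq ∣ z ∣
  n² = seq (re z ℝ-Ring.* re z ℝ-Ring.+ im z ℝ-Ring.* im z)
  -- The root is approximated from below, so lower bounds on v pass to the squared norm without an
  -- error term.
  v²≤n² : ∀ n → v n ℚ.* v n ℚ.≤ n² n
  v²≤n² n = ≡.subst (v n ℚ.* v n ℚ.≤_)
    (ℚ.0≤p⇒∣p∣≡p (0≤+ (0≤p*p (seq (re z) n)) (0≤p*p (seq (im z) n))))
    (√≈-lower (n² n) n)
  -- 7/2 = 224/64 lies just below (15/8)².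
  7/2≤225/64 : 7/2 ℚ.≤ 15/8 ℚ.* 15/8
  7/2≤225/64 = toWitness {a? = 7/2 ℚ.≤? 15/8 ℚ.* 15/8} _
  decide : ∃[ N ] (∀ m n → N ℕ.≤ m → N ℕ.≤ n → ℚ.∣ v m ℚ.- v n ∣ ℚ.< 1/32) →
    ∣ z ∣ <ᴿ fromℤ (+ 2) ⊎ NonNegᴿ (re z ℝ-Ring.* re z ℝ-Ring.+ im z ℝ-Ring.* im z -ᴿ fromℚ 7/2)
  decide (N , close) = go (v N ℚ.≤? 31/16)
    where
    go : Dec (v N ℚ.≤ 31/16) →
      ∣ z ∣ <ᴿ fromℤ (+ 2) ⊎ NonNegᴿ (re z ℝ-Ring.* re z ℝ-Ring.+ im z ℝ-Ring.* im z -ᴿ fromℚ 7/2)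
    -- 31/16 + 1/32 = 63/32 bounds all later terms, which leaves the gap 1/32 below 2. In the other
    -- case they exceed 31/16 - 1/32 = 61/32 > 15/8.
    go (yes v≤) = inj₁ (mk< 1/32 (ℚ.positive⁻¹ 1/32) N λ n N≤n → <-by
      (0<+≤ (p<q⇒0<q-p (∣p∣<q⇒p<q (v n ℚ.- v N) (close n N N≤n ℕ.≤-refl))) (p≤q⇒0≤q-p v≤))
      (solve 2 (λ x y → con 2ℚ :- (x :+ con 1/32) := (con 1/32 :- (x :- y)) :+ (con 31/16 :- y))
        ≡.refl (v n) (v N)))
    go (no v≰) = inj₂ (eventually-nonNeg N λ n N≤n → p≤q⇒0≤q-p
      (ℚ.≤-trans (ℚ.≤-trans 7/2≤225/64 (sq-mono-≤ (ℚ.nonNegative⁻¹ 15/8) (v≥ n N≤n))) (v²≤n² n)))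
      where
      v≥ : ∀ n → N ℕ.≤ n → 15/8 ℚ.≤ v n
      v≥ n N≤n = ℚ.<⇒≤ (<-by
        (0<+ (p<q⇒0<q-p (∣p∣<q⇒p<q (v N ℚ.- v n) (close N n ℕ.≤-refl N≤n)))
          (0<+ (p<q⇒0<q-p (ℚ.≰⇒> v≰)) (ℚ.positive⁻¹ 1/32)))
        (solve 2 (λ x y → x :- con 15/8 := (con 1/32 :- (y :- x)) :+ ((y :- con 31/16) :+ con 1/32))
          ≡.refl (v n) (v N)))

-- The complex numbers as an algebra over the rationals

private
  module ℝᶜ = RingIdentities ℝ-algebra
  module R = ℚ-Algebra ℝ-algebra
  module ℂ-Ring = RawRing ℂ-rawRing

ℂ-isEquivalence : IsEquivalence _≈ᶜ_
ℂ-isEquivalence = record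
  { refl  = mk≈ᶜ R.refl R.refl
  ; sym   = λ { (mk≈ᶜ p q) → mk≈ᶜ (R.sym p) (R.sym q) }
  ; trans = λ { (mk≈ᶜ p q) (mk≈ᶜ p′ q′) → mk≈ᶜ (R.trans p p′) (R.trans q q′) }
  }

+ᶜ-cong : Congruent₂ _≈ᶜ_ ℂ-Ring._+_
+ᶜ-cong (mk≈ᶜ p q) (mk≈ᶜ p′ q′) = mk≈ᶜ (R.+-cong p p′) (R.+-cong q q′)

*ᶜ-cong : Congruent₂ _≈ᶜ_ ℂ-Ring._*_
*ᶜ-cong (mk≈ᶜ p q) (mk≈ᶜ p′ q′) = mk≈ᶜ
  (R.+-cong (R.*-cong p p′) (R.-‿cong (R.*-cong q q′)))
  (R.+-cong (R.*-cong p q′) (R.*-cong q p′))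

*ᶜ-comm : Commutative _≈ᶜ_ ℂ-Ring._*_
*ᶜ-comm x y = mk≈ᶜ
  (ℝᶜ.comm-re (re x) (im x) (re y) (im y))
  (ℝᶜ.comm-im (re x) (im x) (re y) (im y))

ℂ-setoid : Setoid 0ℓ 0ℓ
ℂ-setoid = record { isEquivalence = ℂ-isEquivalence }

private module *ᶜ = Consequences ℂ-setoid

ℂ-commutativeRing : CommutativeRing 0ℓ 0ℓ
ℂ-commutativeRing = record
  { Carrier = ℂ
  ; _≈_ = _≈ᶜ_
  ; _+_ = ℂ-Ring._+_
  ; _*_ = ℂ-Ring._*_
  ; -_ = ℂ-Ring.-_
  ; 0# = ℂ-Ring.0#
  ; 1# = ℂ-Ring.1#
  ; isCommutativeRing = record
    { isRing = record
      { +-isAbelianGroup = record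
        { isGroup = record
          { isMonoid = record
            { isSemigroup = record
              { isMagma = record
                { isEquivalence = ℂ-isEquivalence
                ; ∙-cong = +ᶜ-cong
                }
              ; assoc = λ x y z → mk≈ᶜ (R.+-assoc (re x) (re y) (re z)) (R.+-assoc (im x) (im y) (im z))
              }
            ; identity = (λ x → mk≈ᶜ (R.+-identityˡ (re x)) (R.+-identityˡ (im x)))
                       , (λ x → mk≈ᶜ (R.+-identityʳ (re x)) (R.+-identityʳ (im x)))
            }
          ; inverse = (λ x → mk≈ᶜ (R.-‿inverseˡ (re x)) (R.-‿inverseˡ (im x)))
                    , (λ x → mk≈ᶜ (R.-‿inverseʳ (re x)) (R.-‿inverseʳ (im x)))
          ; ⁻¹-cong = λ { (mk≈ᶜ p q) → mk≈ᶜ (R.-‿cong p) (R.-‿cong q) }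
          }
        ; comm = λ x y → mk≈ᶜ (R.+-comm (re x) (re y)) (R.+-comm (im x) (im y))
        }
      ; *-cong = *ᶜ-cong
      ; *-assoc = λ x y z → mk≈ᶜ
          (ℝᶜ.assoc-re (re x) (im x) (re y) (im y) (re z) (im z))
          (ℝᶜ.assoc-im (re x) (im x) (re y) (im y) (re z) (im z))
      ; *-identity = *ᶜ.comm∧idˡ⇒id *ᶜ-comm λ x → mk≈ᶜ
          (ℝᶜ.identityˡ-re (re x) (im x))
          (ℝᶜ.identityˡ-im (re x) (im x))
      ; distrib = *ᶜ.comm∧distrˡ⇒distr +ᶜ-cong *ᶜ-comm λ x y z → mk≈ᶜ
          (ℝᶜ.distribˡ-re (re x) (im x) (re y) (im y) (re z) (im z))
          (ℝᶜ.distribˡ-im (re x) (im x) (re y) (im y) (re z) (im z))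
      }
    ; *-comm = *ᶜ-comm
    }
  }

fromℝ-cong : ∀ {x y} → x ≈ᴿ y → fromℝ x ≈ᶜ fromℝ y
fromℝ-cong x≈y = mk≈ᶜ x≈y R.refl

fromℝ-+ : ∀ x y → fromℝ (x R.+ y) ≈ᶜ fromℝ x ℂ-Ring.+ fromℝ y
fromℝ-+ x y = mk≈ᶜ R.refl ℝᶜ.0≈0+0

fromℝ-* : ∀ x y → fromℝ (x R.* y) ≈ᶜ fromℝ x ℂ-Ring.* fromℝ y
fromℝ-* x y = mk≈ᶜ (ℝᶜ.real-*-re x y) (ℝᶜ.real-*-im x y)

fromℝ-neg : ∀ x → fromℝ (R.- x) ≈ᶜ ℂ-Ring.- fromℝ x
fromℝ-neg x = mk≈ᶜ R.refl ℝᶜ.0≈-0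

ℂ-algebra : ℚ-Algebra
ℂ-algebra = record
  { commutativeRing = ℂ-commutativeRing
  ; embed = λ q → fromℝ (fromℚ q)
  ; isRingHomomorphism = record
    { isSemiringHomomorphism = record
      { isNearSemiringHomomorphism = record
        { +-isMonoidHomomorphism = record
          { isMagmaHomomorphism = record
            { isRelHomomorphism = record { cong = λ { ≡.refl → mk≈ᶜ R.refl R.refl } }
            ; homo = λ p q → mk≈ᶜ (R.+-homo p q) ℝᶜ.0≈0+0
            }
          ; ε-homo = mk≈ᶜ R.refl R.refl
          }
        ; *-homo = λ p q → mk≈ᶜ
            (R.trans (R.*-homo p q) (ℝᶜ.real-*-re (fromℚ p) (fromℚ q)))
            (ℝᶜ.real-*-im (fromℚ p) (fromℚ q))
        }
      ; 1#-homo = mk≈ᶜ R.refl R.refl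
      }
    ; -‿homo = λ q → mk≈ᶜ (R.-‿homo q) ℝᶜ.0≈-0
    }
  }

-- This makes the hypothesis γ ≠ β usable in the form in which it is given, as a mere negation.
ℂ-zero-product : ∀ {w z} → ¬ (w ≈ᶜ ℂ-Ring.0#) → w ℂ-Ring.* z ≈ᶜ ℂ-Ring.0# → z ≈ᶜ ℂ-Ring.0#
ℂ-zero-product {w} {z} w≉0 (mk≈ᶜ re≈0 im≈0) =
  let (re-z≈0 , im-z≈0) = ComplexNorm.zero-product ℝ-ordered {re w} {im w} {re z} {im z}
                            (λ (re-w≈0 , im-w≈0) → w≉0 (mk≈ᶜ re-w≈0 im-w≈0)) re≈0 im≈0
  in mk≈ᶜ re-z≈0 im-z≈0

private
  module P = Polynomials ℂ-algebra
  module H = HornerSums ℂ-algebra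
  module O = Orbit ℝ-ordered
  module ℂᶜ = RingIdentities ℂ-algebra
  module C = ℚ-Algebra ℂ-algebra

-- Roots of the Ito-Sadahiro polynomial of β

module _ (β : ℝ) (1<β : ℝ-Ring.1# <ᴿ β) where

  open Expansion β 1<β
  open _<ᴿ_ 1<β using (gap; 0<gap)

  r≈l+1 : r ≈ᴿ l R.+ R.1#
  r≈l+1 = ℝᶜ.r≈1-βr (recip-inverse (β R.+ R.1#) 0<β+1)

  l≈-βr : l ≈ᴿ R.- β R.* r
  l≈-βr = ℝᶜ.-x≈-βx β r

  module _ {d : ℕ → ℤ} (expansion : IsExpansion l d) where

    open IsExpansion expansion renaming (orbit to t)

    dᴿ : ℕ → ℝ
    dᴿ n = fromℤ (d n)

    orbit-step : ∀ n → t (suc n) ≈ᴿ R.- β R.* t n -ᴿ dᴿ n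
    orbit-step n = Step.image (step n)

    orbit-bounds : ∀ n → NonNegᴿ (t n -ᴿ l) × NonNegᴿ (r -ᴿ t n)
    orbit-bounds zero    = O.start-bounds r≈l+1 start
    orbit-bounds (suc n) =
      let (k≤x , x<k+1) = Step.digit (step n)
      in O.step-bounds {β} {l} {r} {t n} {t (suc n)} {dᴿ n} (_<ᴿ_.gap x<k+1) (_<ᴿ_.0<gap x<k+1)
           r≈l+1 (orbit-step n) (≤ᴿ⇒nonNeg k≤x) (<ᴿ⇒nonNeg x<k+1)

    u : ℕ → ℝ
    u n = r -ᴿ t n

    u≤1 : ∀ n → NonNegᴿ (R.1# -ᴿ u n)
    u≤1 n = nonNegᴿ-resp (O.complement r≈l+1) (proj₁ (orbit-bounds n))

    u₀≈1 : u 0 ≈ᴿ R.1#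
    u₀≈1 = R.trans (R.+-congˡ (R.-‿cong start)) (ℝᶜ.x-[x-1]≈1 r≈l+1)

    module _ {m p : ℕ} (form : IsPeriodicForm d m p) where

      open IsPeriodicForm form

      t-periodic : ∀ n → m ℕ.≤ n → t (n ℕ.+ p) ≈ᴿ t n
      t-periodic = O.orbit-periodic 0<gap (<ᴿ⇒nonNeg 1<β) r≈l+1
        (λ n → proj₁ (orbit-bounds n)) (λ n → proj₂ (orbit-bounds n)) orbit-step m p
        (λ n m≤n → R.reflexive (≡.cong fromℤ (periodic n m≤n)))

      lᶜ≈ : fromℝ l C.≈ fromℝ (R.- β) C.* fromℝ r
      lᶜ≈ = C.trans (fromℝ-cong l≈-βr) (fromℝ-* (R.- β) r)

      rᶜ≈ : fromℝ r C.≈ fromℝ l C.+ C.1#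
      rᶜ≈ = C.trans (fromℝ-cong r≈l+1) (fromℝ-+ l R.1#)

      stepᶜ : ∀ n → fromℝ (t (suc n)) C.≈ fromℝ (R.- β) C.* fromℝ (t n) C.- fromℝ (dᴿ n)
      stepᶜ n = C.trans (fromℝ-cong (orbit-step n)) (C.trans (fromℝ-+ (R.- β R.* t n) (R.- dᴿ n))
        (C.+-cong (fromℝ-* (R.- β) (t n)) (fromℝ-neg (dᴿ n))))

      U : ℂ → ℕ → ℂ
      U y = H.remainders lᶜ≈ rᶜ≈ (fromℝ-cong start) stepᶜ y

      factor : ∀ γ → itoSadahiroPolynomial d m p γ C.≈
        (C.- γ C.- fromℝ (R.- β)) C.* (U (C.- γ) (m ℕ.+ p) C.- U (C.- γ) m)
      factor γ = H.polynomial-factor lᶜ≈ rᶜ≈ (fromℝ-cong start) stepᶜ (C.- γ) m p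
        (fromℝ-cong (t-periodic m ℕ.≤-refl))

      -- The first factor is β - γ, which vanishes at γ = β. That β is itself a root is what the
      -- conjugates inherit.
      β-root : itoSadahiroPolynomial d m p (fromℝ β) C.≈ C.0#
      β-root = C.trans (factor (fromℝ β)) (C.trans
        (C.*-congʳ (C.trans (C.+-congˡ (C.-‿cong (fromℝ-neg β))) (C.-‿inverseʳ (C.- fromℝ β))))
        (C.zeroˡ _))

      large-root⇒⊥ : ∀ γ → ¬ (γ C.≈ fromℝ β) → itoSadahiroPolynomial d m p γ C.≈ C.0# →
        ¬ NonNegᴿ (re γ R.* re γ R.+ im γ R.* im γ -ᴿ fromℚ (+ 7 ℚ./ 2))
      large-root⇒⊥ γ γ≉β root ∣γ∣≥ = NormGrowth.not-eventually-periodic ℝ-ordered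
        (R.- re γ) (R.- im γ) u (λ n → re (U y n)) (λ n → im (U y n))
        (nonNegᴿ-resp (ℝᶜ.norm-neg (re γ) (im γ) (+ 7 ℚ./ 2)) ∣γ∣≥)
        (λ n → proj₂ (orbit-bounds n)) u≤1 u₀≈1 R.refl R.refl
        -- The recursion of the real parts holds by definition; in the imaginary parts, the real
        -- input uₙ leaves a term 0 - 0 to be removed.
        (λ n → R.refl) (λ n → ℝᶜ.step-im _)
        m p 1≤p
        (λ n m≤n → _≈ᶜ_.re≈ (U-periodic n m≤n)) (λ n m≤n → _≈ᶜ_.im≈ (U-periodic n m≤n))
        where
        y : ℂ
        y = C.- γ
        y≉-β : ¬ (y C.- fromℝ (R.- β) C.≈ C.0#)
        y≉-β y≈-β = γ≉β (ℂᶜ.difference-of-negations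
          (C.trans (C.+-congˡ (C.-‿cong (C.sym (fromℝ-neg β)))) y≈-β))
        U-difference : U y (m ℕ.+ p) C.- U y m C.≈ C.0#
        U-difference = ℂ-zero-product y≉-β (C.trans (C.sym (factor γ)) root)
        U-periodic : ∀ n → m ℕ.≤ n → U y (n ℕ.+ p) C.≈ U y n
        U-periodic = H.remainders-periodic lᶜ≈ rᶜ≈ (fromℝ-cong start) stepᶜ y m p
          (λ n m≤n → fromℝ-cong (t-periodic n m≤n)) (ℂᶜ.difference≈0 U-difference)

      root-bound : ∀ γ → ¬ (γ C.≈ fromℝ β) → itoSadahiroPolynomial d m p γ C.≈ C.0# → ∣ γ ∣ <ᴿ fromℤ (+ 2)
      root-bound γ γ≉β root = bound (∣z∣<2∨∣z∣²≥7/2 γ)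
        where
        bound : ∣ γ ∣ <ᴿ fromℤ (+ 2) ⊎
          NonNegᴿ (re γ R.* re γ R.+ im γ R.* im γ -ᴿ fromℚ (+ 7 ℚ./ 2)) → ∣ γ ∣ <ᴿ fromℤ (+ 2)
        bound (inj₁ ∣γ∣<2) = ∣γ∣<2
        bound (inj₂ ∣γ∣≥)  = contradiction ∣γ∣≥ (large-root⇒⊥ γ γ≉β root)

      conjugate-root : ∀ γ → γ IsConjugateOf fromℝ β → itoSadahiroPolynomial d m p γ C.≈ C.0#
      conjugate-root γ (n , a , (β-root-a , minimal) , γ-root-a) = P.conjugate-root {fromℝ β} {γ} {n} {a}
        β-root-a γ-root-a minimal (P.polynomial-isPolynomial (λ i → d i ℚ./ 1) m p) β-root

open Defs using (_≈_; 0#)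

theorem1 : (β : ℝ) (1<β : fromℤ (+ 1) <ᴿ β) →
    IsItoSadahiro β 1<β →
    (d : ℕ → ℤ) → Expansion.IsExpansion β 1<β (Expansion.l β 1<β) d →
    (m p : ℕ) → IsMinimalForm d m p →
    (∀ (γ : ℂ) → ¬ (γ ≈ fromℝ β) → itoSadahiroPolynomial d m p γ ≈ 0# → ∣ γ ∣ <ᴿ fromℤ (+ 2)) ×
    (∀ (γ : ℂ) → ¬ (γ ≈ fromℝ β) → γ IsConjugateOf fromℝ β → ∣ γ ∣ <ᴿ fromℤ (+ 2))
theorem1 β 1<β _ d expansion m p minimal-form =
    root-bound β 1<β expansion form
  , λ γ γ≉β γ∼β → root-bound β 1<β expansion form γ γ≉β (conjugate-root β 1<β expansion form γ γ∼β)
  where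
  form : IsPeriodicForm d m p
  form = IsMinimalForm.form minimal-form
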